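{- The number of leaves in a uniformly random rooted map with $n$ edges (no restriction on genus) converges in distribution, as $n\to\infty$, to the Poisson law with parameter $1$.
   Context: A map is a connected multigraph (loops and multiple edges allowed) endowed with a cyclic ordering of the half-edges incident to each vertex. The degree of a vertex is the number of half-edges incident to it; a leaf is a vertex of degree 1. Around each vertex, each pair of consecutive half-edges in the cyclic order forms a corner (a vertex with only one half-edge has one corner; a vertex of degree $d\ge1$ has $d$ corners; the one-vertex map with no edge has exactly one corner). A rooted map is a map with a distinguished corner. Rooted maps are considered up to isomorphisms preserving the graph structure, the root corner and the cyclic orderings. "Random rooted map with $n$ edges" means that all rooted maps with $n$ edges are equally likely. -}

module Defs where

open import Level using (0ℓ)
open import Data.Bool.Base using (Bool; true; false; not; if_then_else_)
import Data.Bool.Properties as Bool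
open import Data.Empty using (⊥)
open import Data.Fin.Base using (Fin; zero; suc; inject₁; fromℕ; combine)
import Data.Fin.Properties as Fin
open import Data.Fin.Induction using (<-weakInduction; >-weakInduction)
open import Data.Integer.Base as ℤ using (+_; -[1+_]; -1ℤ; 1ℤ)
import Data.Integer.Properties as ℤ
open import Data.List.Base
  using (List; []; _∷_; _++_; [_]; length; filter; allFin; upTo; map; concatMap;
         cartesianProduct; cartesianProductWith; deduplicate)
open import Data.List.Membership.Propositional using (_∈_)
open import Data.List.Membership.Propositional.Properties
  using (∈-allFin; ∈-upTo⁺; ∈-cartesianProduct⁺)
import Data.List.Membership.Setoid.Properties as Membershipₛ
open import Data.List.Relation.Unary.Any as Any using (Any; here; there; any?)
import Data.List.Relation.Unary.Any.Properties as Any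
open import Data.List.Relation.Unary.Enumerates.Setoid using (IsEnumeration)
open import Data.List.Relation.Unary.Unique.Setoid using (Unique)
open import Data.List.Relation.Unary.Unique.DecSetoid.Properties using (deduplicate-!)
open import Data.Nat.Base as ℕ using (ℕ; zero; suc; NonZero; _!; z≤n; s≤s)
import Data.Nat.Properties as ℕ
open import Data.Product.Base using (∃; _×_; _,_; proj₁; proj₂)
open import Data.Product.Properties using (≡-dec)
open import Data.Rational.Base as ℚ
  using (ℚ; 0ℚ; 1ℚ; _/_; _<_; _≤_; _+_; _-_; _*_; -_; ∣_∣; floor; toℚᵘ; 1/_; Positive)
import Data.Rational.Properties as ℚ
import Data.Rational.Unnormalised.Base as ℚᵘ
import Data.Rational.Unnormalised.Properties as ℚᵘ
open import Data.Rational.Solver using (module +-*-Solver)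
import Data.Nat.Solver as ℕS
open import Data.Sum.Base using (_⊎_; inj₁; inj₂)
import Data.Vec.Functional as Vector
open import Function.Base using (_∘_; id)
open import Function.Bundles using (_↔_; mk↔ₛ′; Inverse)
open import Function.Properties.Inverse using (↔-refl; ↔-sym; ↔-trans)
open import Relation.Binary.Bundles using (Setoid; DecSetoid)
open import Relation.Binary.Construct.Closure.ReflexiveTransitive as Star
  using (Star; _◅_; _◅◅_)
open import Relation.Binary.Core using (Rel)
open import Relation.Binary.Definitions using (Decidable)
open import Relation.Binary.PropositionalEquality
  using (_≡_; _≢_; _≗_; refl; sym; trans; cong; subst; subst₂)
open import Relation.Nullary.Decidable using (Dec; yes; no; _×-dec_; _⊎-dec_; _→-dec_; map′; ¬?)
open import Relation.Nullary.Negation using (contradiction)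
import Relation.Unary as U

-- The n edges are Fin n; the half-edges of the edge e are (e , false)
-- and (e , true).

HalfEdge : ℕ → Set
HalfEdge n = Fin n × Bool

opposite : ∀ {n} → HalfEdge n → HalfEdge n
opposite (e , b) = e , not b

record Map (n : ℕ) : Set where
  field
    #vertices : ℕ

  Vertex : Set
  Vertex = Fin #vertices

  field
    vertexOf : HalfEdge n → Vertex
    next     : HalfEdge n → HalfEdge n

  Adjacent : Rel Vertex 0ℓ
  Adjacent u v = ∃ λ h → vertexOf h ≡ u × vertexOf (opposite h) ≡ v

  Next : Rel (HalfEdge n) 0ℓ
  Next h h′ = next h ≡ h′

  field
    -- next restricts to a self-map of the finite set of half-edges at
    -- each vertex, and iterating it leads from any of them to any
    -- other.  Hence the restriction is a permutation with one cycle.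
    next-vertexOf : ∀ h → vertexOf (next h) ≡ vertexOf h
    next-cyclic   : ∀ h h′ → vertexOf h ≡ vertexOf h′ → Star Next h h′
    connected     : ∀ u v → Star Adjacent u v

open Map public

-- The empty graph is a Map 0, but it has no corner, hence no rooting.
-- `after h` is the corner between h and next h.

data Corner {n} (m : Map n) : Set where
  after : HalfEdge n → Corner m
  alone : ∀ v → (∀ h → vertexOf m h ≢ v) → Corner m

record RootedMap (n : ℕ) : Set where
  constructor _rootedAt_
  field
    mapOf : Map n
    root  : Corner mapOf

open RootedMap public

halfEdges : ∀ n → List (HalfEdge n)
halfEdges n = cartesianProduct (allFin n) (false ∷ true ∷ [])

degree : ∀ {n} (m : Map n) → Vertex m → ℕ
degree {n} m v = length (filter (λ h → vertexOf m h Fin.≟ v) (halfEdges n))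

#leaves : ∀ {n} → Map n → ℕ
#leaves m = length (filter (λ v → degree m v ℕ.≟ 1) (allFin (#vertices m)))

record Iso {n} (m m′ : Map n) : Set where
  field
    vertices  : Vertex m ↔ Vertex m′
    halfedges : HalfEdge n ↔ HalfEdge n

  onVertex : Vertex m → Vertex m′
  onVertex = Inverse.to vertices

  onHalfEdge : HalfEdge n → HalfEdge n
  onHalfEdge = Inverse.to halfedges

  field
    vertexOf-iso : ∀ h → vertexOf m′ (onHalfEdge h) ≡ onVertex (vertexOf m h)
    opposite-iso : ∀ h → onHalfEdge (opposite h) ≡ opposite (onHalfEdge h)
    next-iso     : ∀ h → onHalfEdge (next m h) ≡ next m′ (onHalfEdge h)

open Iso public

CornerImage : ∀ {n} {m m′ : Map n} → (HalfEdge n → HalfEdge n) → (Vertex m → Vertex m′) →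
              Corner m → Corner m′ → Set
CornerImage f g (after h)   (after h′)   = f h ≡ h′
CornerImage f g (alone v _) (alone v′ _) = g v ≡ v′
CornerImage f g _           _            = ⊥

record _≅_ {n} (M M′ : RootedMap n) : Set where
  field
    iso      : Iso (mapOf M) (mapOf M′)
    root-iso : CornerImage (onHalfEdge iso) (onVertex iso) (root M) (root M′)

Iso-refl : ∀ {n} {m : Map n} → Iso m m
Iso-refl = record
  { vertices     = ↔-refl
  ; halfedges    = ↔-refl
  ; vertexOf-iso = λ _ → refl
  ; opposite-iso = λ _ → refl
  ; next-iso     = λ _ → refl
  }

Iso-sym : ∀ {n} {m m′ : Map n} → Iso m m′ → Iso m′ m
Iso-sym {n} {m} {m′} i = record
  { vertices     = ↔-sym (vertices i)
  ; halfedges    = ↔-sym (halfedges i)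
  ; vertexOf-iso = λ h → trans (sym (V.strictlyInverseʳ _))
      (cong V.from (trans (sym (vertexOf-iso i _)) (cong (vertexOf m′) (H.strictlyInverseˡ h))))
  ; opposite-iso = λ h → trans (cong (H.from ∘ opposite) (sym (H.strictlyInverseˡ h)))
      (trans (cong H.from (sym (opposite-iso i _))) (H.strictlyInverseʳ _))
  ; next-iso     = λ h → trans (cong (H.from ∘ next m′) (sym (H.strictlyInverseˡ h)))
      (trans (cong H.from (sym (next-iso i _))) (H.strictlyInverseʳ _))
  }
  where
  module V = Inverse (vertices i)
  module H = Inverse (halfedges i)

Iso-trans : ∀ {n} {m₁ m₂ m₃ : Map n} → Iso m₁ m₂ → Iso m₂ m₃ → Iso m₁ m₃
Iso-trans i j = record
  { vertices     = ↔-trans (vertices i) (vertices j)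
  ; halfedges    = ↔-trans (halfedges i) (halfedges j)
  ; vertexOf-iso = λ h → trans (vertexOf-iso j _) (cong (onVertex j) (vertexOf-iso i h))
  ; opposite-iso = λ h → trans (cong (onHalfEdge j) (opposite-iso i h)) (opposite-iso j _)
  ; next-iso     = λ h → trans (cong (onHalfEdge j) (next-iso i h)) (next-iso j _)
  }

≅-refl : ∀ {n} {M : RootedMap n} → M ≅ M
≅-refl {M = M} = record { iso = Iso-refl ; root-iso = image (root M) }
  where
  image : ∀ c → CornerImage id id c c
  image (after h)   = refl
  image (alone v _) = refl

≅-sym : ∀ {n} {M M′ : RootedMap n} → M ≅ M′ → M′ ≅ M
≅-sym {M = M} {M′} p = record { iso = Iso-sym i ; root-iso = image (root M) (root M′) (_≅_.root-iso p) }
  where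
  i = _≅_.iso p
  image : ∀ c c′ → CornerImage (onHalfEdge i) (onVertex i) c c′ →
          CornerImage (onHalfEdge (Iso-sym i)) (onVertex (Iso-sym i)) c′ c
  image (after h)   (after _)   refl = Inverse.strictlyInverseʳ (halfedges i) h
  image (alone v _) (alone _ _) refl = Inverse.strictlyInverseʳ (vertices i) v

≅-trans : ∀ {n} {M₁ M₂ M₃ : RootedMap n} → M₁ ≅ M₂ → M₂ ≅ M₃ → M₁ ≅ M₃
≅-trans {M₁ = M₁} {M₂} {M₃} p q = record
  { iso      = Iso-trans i j
  ; root-iso = image (root M₁) (root M₂) (root M₃) (_≅_.root-iso p) (_≅_.root-iso q)
  }
  where
  i = _≅_.iso p
  j = _≅_.iso q
  image : ∀ c₁ c₂ c₃ → CornerImage (onHalfEdge i) (onVertex i) c₁ c₂ →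
          CornerImage (onHalfEdge j) (onVertex j) c₂ c₃ →
          CornerImage (onHalfEdge (Iso-trans i j)) (onVertex (Iso-trans i j)) c₁ c₃
  image (after _)   (after _)   (after _)   refl refl = refl
  image (alone _ _) (alone _ _) (alone _ _) refl refl = refl

rootedMapSetoid : ℕ → Setoid 0ℓ 0ℓ
rootedMapSetoid n = record
  { Carrier       = RootedMap n
  ; _≈_           = _≅_
  ; isEquivalence = record { refl = ≅-refl ; sym = ≅-sym ; trans = ≅-trans }
  }

∈-bools : ∀ b → b ∈ false ∷ true ∷ []
∈-bools false = here refl
∈-bools true  = there (here refl)

∈-halfEdges : ∀ {n} (h : HalfEdge n) → h ∈ halfEdges n
∈-halfEdges (e , b) = ∈-cartesianProduct⁺ (∈-allFin e) (∈-bools b)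

_≟ₕ_ : ∀ {n} → Decidable {A = HalfEdge n} _≡_
_≟ₕ_ = ≡-dec Fin._≟_ Bool._≟_

allHalfEdges? : ∀ {n} {P : HalfEdge n → Set} → U.Decidable P → Dec (∀ h → P h)
allHalfEdges? {P = P} P? =
  map′ (λ p → λ { (e , false) → proj₁ (p e) ; (e , true) → proj₂ (p e) })
       (λ p e → p (e , false) , p (e , true))
       (Fin.all? λ e → P? (e , false) ×-dec P? (e , true))

anyHalfEdge? : ∀ {n} {P : HalfEdge n → Set} → U.Decidable P → Dec (∃ P)
anyHalfEdge? {n} {P} P? =
  map′ Any.satisfied (λ (h , p) → Any.map (λ { refl → p }) (∈-halfEdges h))
       (any? P? (halfEdges n))

functions : ∀ {B : Set} → List B → ∀ n → List (Fin n → B)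
functions bs zero    = [ (λ ()) ]
functions bs (suc n) = cartesianProductWith Vector._∷_ bs (functions bs n)

∈-functions : ∀ {B : Set} {bs : List B} → (∀ b → b ∈ bs) → ∀ {n} (f : Fin n → B) →
              Any (f ≗_) (functions bs n)
∈-functions all {zero}  f = here λ ()
∈-functions all {suc n} f =
  Any.cartesianProductWith⁺ Vector._∷_
    (λ p q → λ { zero → p ; (suc i) → q i })
    (all (f zero)) (∈-functions all (f ∘ suc))

fromPairs : ∀ {B : Set} {n} → (Fin n → B × B) → HalfEdge n → B
fromPairs f (e , b) = if b then proj₂ (f e) else proj₁ (f e)

halfEdgeFunctions : ∀ {B : Set} → List B → ∀ n → List (HalfEdge n → B)
halfEdgeFunctions bs n = map fromPairs (functions (cartesianProduct bs bs) n)

∈-halfEdgeFunctions : ∀ {B : Set} {bs : List B} → (∀ b → b ∈ bs) → ∀ {n} (f : HalfEdge n → B) →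
                      Any (f ≗_) (halfEdgeFunctions bs n)
∈-halfEdgeFunctions all f =
  Any.map⁺ (Any.map
    (λ p → λ { (e , false) → cong proj₁ (p e) ; (e , true) → cong proj₂ (p e) })
    (∈-functions (λ (b , b′) → ∈-cartesianProduct⁺ (all b) (all b′))
                 (λ e → f (e , false) , f (e , true))))

-- Warshall's algorithm: Via zs x y holds iff there is an R-path from x
-- to y all of whose inner points are in zs.

module Reachability {A : Set} {R : Rel A 0ℓ} (_≟_ : Decidable {A = A} _≡_) (R? : Decidable R) where

  Via : List A → Rel A 0ℓ
  Via []       x y = x ≡ y ⊎ R x y
  Via (z ∷ zs) x y = Via zs x y ⊎ (Via zs x z × Via zs z y)

  via? : ∀ zs → Decidable (Via zs)
  via? []       x y = (x ≟ y) ⊎-dec R? x y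
  via? (z ∷ zs) x y = via? zs x y ⊎-dec (via? zs x z ×-dec via? zs z y)

  via⇒star : ∀ zs {x y} → Via zs x y → Star R x y
  via⇒star []       (inj₁ refl)    = Star.ε
  via⇒star []       (inj₂ r)       = r ◅ Star.ε
  via⇒star (z ∷ zs) (inj₁ p)       = via⇒star zs p
  via⇒star (z ∷ zs) (inj₂ (p , q)) = via⇒star zs p ◅◅ via⇒star zs q

  via-base : ∀ zs {x y} → Via [] x y → Via zs x y
  via-base []       p = p
  via-base (_ ∷ zs) p = inj₁ (via-base zs p)

  via-trans : ∀ {zs x w y} → w ∈ zs → Via zs x w → Via zs w y → Via zs x y
  via-trans (here refl) p q = inj₂ (start p , end q)
    where
    start : ∀ {x z zs} → Via (z ∷ zs) x z → Via zs x z
    start (inj₁ p)       = p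
    start (inj₂ (p , _)) = p
    end : ∀ {y z zs} → Via (z ∷ zs) z y → Via zs z y
    end (inj₁ p)       = p
    end (inj₂ (_ , p)) = p
  via-trans (there w∈) (inj₁ p)       (inj₁ q)       = inj₁ (via-trans w∈ p q)
  via-trans (there w∈) (inj₁ p)       (inj₂ (q , r)) = inj₂ (via-trans w∈ p q , r)
  via-trans (there w∈) (inj₂ (p , q)) (inj₁ r)       = inj₂ (p , via-trans w∈ q r)
  via-trans (there w∈) (inj₂ (p , q)) (inj₂ (r , s)) = inj₂ (p , s)

  star? : ∀ {zs} → (∀ z → z ∈ zs) → Decidable (Star R)
  star? {zs} all x y = map′ (via⇒star zs) star⇒via (via? zs x y)
    where
    star⇒via : ∀ {x y} → Star R x y → Via zs x y
    star⇒via Star.ε       = via-base zs (inj₁ refl)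
    star⇒via (r ◅ p) = via-trans (all _) (via-base zs (inj₂ r)) (star⇒via p)

cornerImage? : ∀ {n} {m m′ : Map n} f (g : Vertex m → Vertex m′) →
               Decidable (CornerImage {m = m} {m′} f g)
cornerImage? f g (after h)   (after h′)   = f h ≟ₕ h′
cornerImage? f g (alone v _) (alone v′ _) = g v Fin.≟ v′
cornerImage? f g (after _)   (alone _ _)  = no λ ()
cornerImage? f g (alone _ _) (after _)    = no λ ()

module _ {n} (M M′ : RootedMap n) where

  private
    m  = mapOf M
    m′ = mapOf M′

    Maps : Set
    Maps = ((HalfEdge n → HalfEdge n) × (HalfEdge n → HalfEdge n)) ×
           ((Vertex m → Vertex m′) × (Vertex m′ → Vertex m))

    IsIso : Maps → Set
    IsIso ((f , f′) , (g , g′)) =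
      (∀ h → f (f′ h) ≡ h) × (∀ h → f′ (f h) ≡ h) ×
      (∀ v → g (g′ v) ≡ v) × (∀ v → g′ (g v) ≡ v) ×
      (∀ h → vertexOf m′ (f h) ≡ g (vertexOf m h)) ×
      (∀ h → f (opposite h) ≡ opposite (f h)) ×
      (∀ h → f (next m h) ≡ next m′ (f h)) ×
      CornerImage f g (root M) (root M′)

    isIso? : U.Decidable IsIso
    isIso? ((f , f′) , (g , g′)) =
      allHalfEdges? (λ h → f (f′ h) ≟ₕ h) ×-dec allHalfEdges? (λ h → f′ (f h) ≟ₕ h) ×-dec
      Fin.all? (λ v → g (g′ v) Fin.≟ v) ×-dec Fin.all? (λ v → g′ (g v) Fin.≟ v) ×-dec
      allHalfEdges? (λ h → vertexOf m′ (f h) Fin.≟ g (vertexOf m h)) ×-dec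
      allHalfEdges? (λ h → f (opposite h) ≟ₕ opposite (f h)) ×-dec
      allHalfEdges? (λ h → f (next m h) ≟ₕ next m′ (f h)) ×-dec
      cornerImage? f g (root M) (root M′)

    allMaps : List Maps
    allMaps = cartesianProduct
      (cartesianProduct (halfEdgeFunctions (halfEdges n) n) (halfEdgeFunctions (halfEdges n) n))
      (cartesianProduct (functions (allFin _) _) (functions (allFin _) _))

    _≗₄_ : Maps → Maps → Set
    ((f₁ , f₁′) , (g₁ , g₁′)) ≗₄ ((f₂ , f₂′) , (g₂ , g₂′)) =
      ((f₁ ≗ f₂) × (f₁′ ≗ f₂′)) × ((g₁ ≗ g₂) × (g₁′ ≗ g₂′))

    ∈-allMaps : ∀ x → Any (x ≗₄_) allMaps
    ∈-allMaps ((f , f′) , (g , g′)) =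
      Any.cartesianProduct⁺
        (Any.cartesianProduct⁺ (∈-halfEdgeFunctions ∈-halfEdges f) (∈-halfEdgeFunctions ∈-halfEdges f′))
        (Any.cartesianProduct⁺ (∈-functions ∈-allFin g) (∈-functions ∈-allFin g′))

    cornerImage-resp : ∀ {f₁ f₂ g₁ g₂} → f₁ ≗ f₂ → g₁ ≗ g₂ → (c : Corner m) (c′ : Corner m′) →
                       CornerImage f₁ g₁ c c′ → CornerImage f₂ g₂ c c′
    cornerImage-resp p q (after h)   (after _)   eq = trans (sym (p h)) eq
    cornerImage-resp p q (alone v _) (alone _ _) eq = trans (sym (q v)) eq

    isIso-resp : ∀ {x y} → x ≗₄ y → IsIso x → IsIso y
    isIso-resp {(f₁ , f₁′) , (g₁ , g₁′)} {(f₂ , f₂′) , (g₂ , g₂′)}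
               ((f , f′) , (g , g′)) (a , b , c , d , i , j , k , r) =
      (λ h → trans (trans (sym (f _)) (cong f₁ (sym (f′ h)))) (a h)) ,
      (λ h → trans (trans (sym (f′ _)) (cong f₁′ (sym (f h)))) (b h)) ,
      (λ v → trans (trans (sym (g _)) (cong g₁ (sym (g′ v)))) (c v)) ,
      (λ v → trans (trans (sym (g′ _)) (cong g₁′ (sym (g v)))) (d v)) ,
      (λ h → trans (cong (vertexOf m′) (sym (f h))) (trans (i h) (g _))) ,
      (λ h → trans (sym (f _)) (trans (j h) (cong opposite (f h)))) ,
      (λ h → trans (sym (f _)) (trans (k h) (cong (next m′) (f h)))) ,
      cornerImage-resp f g (root M) (root M′) r

    toIso : ∃ IsIso → M ≅ M′
    toIso (((f , f′) , (g , g′)) , (a , b , c , d , i , j , k , r)) = record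
      { iso = record
        { vertices     = mk↔ₛ′ g g′ c d
        ; halfedges    = mk↔ₛ′ f f′ a b
        ; vertexOf-iso = i
        ; opposite-iso = j
        ; next-iso     = k
        }
      ; root-iso = r
      }

    fromIso : M ≅ M′ → ∃ IsIso
    fromIso p =
      ((H.to , H.from) , (V.to , V.from)) ,
      H.strictlyInverseˡ , H.strictlyInverseʳ , V.strictlyInverseˡ , V.strictlyInverseʳ ,
      vertexOf-iso i , opposite-iso i , next-iso i , _≅_.root-iso p
      where
      i = _≅_.iso p
      module V = Inverse (vertices i)
      module H = Inverse (halfedges i)

  infix 4 _≅?_
  _≅?_ : Dec (M ≅ M′)
  _≅?_ = map′ (toIso ∘ Any.satisfied)
    (λ p → let x , x-iso = fromIso p in Any.map (λ {y} e → isIso-resp {x} {y} e x-iso) (∈-allMaps x))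
    (any? isIso? allMaps)

rootedMapDecSetoid : ℕ → DecSetoid 0ℓ 0ℓ
rootedMapDecSetoid n = record
  { Carrier          = RootedMap n
  ; _≈_              = _≅_
  ; isDecEquivalence = record
    { isEquivalence = Setoid.isEquivalence (rootedMapSetoid n)
    ; _≟_           = _≅?_
    }
  }

module _ {n V : ℕ} (a : HalfEdge n → Fin V) (s : HalfEdge n → HalfEdge n) where

  IsMap : Set
  IsMap = (∀ h → a (s h) ≡ a h) ×
          (∀ h h′ → a h ≡ a h′ → Star (λ x y → s x ≡ y) h h′) ×
          (∀ u v → Star (λ u v → ∃ λ h → a h ≡ u × a (opposite h) ≡ v) u v)

  isMap? : Dec IsMap
  isMap? =
    allHalfEdges? (λ h → a (s h) Fin.≟ a h) ×-dec
    allHalfEdges? (λ h → allHalfEdges? λ h′ → (a h Fin.≟ a h′) →-dec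
      Reachability.star? _≟ₕ_ (λ x y → s x ≟ₕ y) ∈-halfEdges h h′) ×-dec
    Fin.all? (λ u → Fin.all? λ v →
      Reachability.star? Fin._≟_
        (λ u v → anyHalfEdge? λ h → (a h Fin.≟ u) ×-dec (a (opposite h) Fin.≟ v)) ∈-allFin u v)

  toMap : IsMap → Map n
  toMap (p , q , r) = record
    { #vertices     = V
    ; vertexOf      = a
    ; next          = s
    ; next-vertexOf = p
    ; next-cyclic   = q
    ; connected     = r
    }

  asMap : List (Map n)
  asMap with isMap?
  ... | yes p = [ toMap p ]
  ... | no _  = []

asMap-complete : ∀ {n} (m : Map n) {a s} → vertexOf m ≗ a → next m ≗ s →
                 Any (Iso m) (asMap a s)
asMap-complete m {a} {s} p q with isMap? a s
... | yes _  = here record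
  { vertices     = ↔-refl
  ; halfedges    = ↔-refl
  ; vertexOf-iso = λ h → sym (p h)
  ; opposite-iso = λ _ → refl
  ; next-iso     = q
  }
... | no ¬ok = contradiction
  ( (λ h → trans (cong a (sym (q h))) (trans (sym (p _)) (trans (next-vertexOf m h) (p h))))
  , (λ h h′ e → Star.map (λ {x} e → trans (sym (q x)) e)
                  (next-cyclic m h h′ (trans (p h) (trans e (sym (p h′))))))
  , (λ u v → Star.map (λ (h , e , e′) → h , trans (sym (p h)) e , trans (sym (p _)) e′)
               (connected m u v))
  ) ¬ok

mapsWithIncidence : ∀ {n V} → (HalfEdge n → Fin V) → List (Map n)
mapsWithIncidence {n} a = concatMap (asMap a) (halfEdgeFunctions (halfEdges n) n)

mapsWithVertices : ∀ n → ℕ → List (Map n)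
mapsWithVertices n V = concatMap mapsWithIncidence (halfEdgeFunctions (allFin V) n)

maps : ∀ n → List (Map n)
maps n = concatMap (mapsWithVertices n) (upTo (suc (suc (n ℕ.* 2))))

#vertices-bound : ∀ {n} (m : Map n) → #vertices m ℕ.≤ suc (n ℕ.* 2)
#vertices-bound {n} m = bound (#vertices m) (vertexOf m) (connected m)
  where
  code : HalfEdge n → Fin (n ℕ.* 2)
  code (e , b) = combine e (if b then suc zero else zero)

  code-injective : ∀ {h h′} → code h ≡ code h′ → h ≡ h′
  code-injective {e , b} {e′ , b′} p
    with Fin.combine-injective e _ e′ _ p
  code-injective {_ , false} {_ , false} p | refl , _ = refl
  code-injective {_ , true}  {_ , true}  p | refl , _ = refl

  bound : ∀ V (a : HalfEdge n → Fin V) →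
          (∀ u v → Star (λ u v → ∃ λ h → a h ≡ u × a (opposite h) ≡ v) u v) →
          V ℕ.≤ suc (n ℕ.* 2)
  bound zero    a conn = z≤n
  bound (suc V) a conn = s≤s (Fin.injective⇒≤ {f = code ∘ proj₁ ∘ witness} λ {u} {v} p →
    Fin.suc-injective (trans (sym (proj₂ (witness u)))
      (trans (cong a (code-injective p)) (proj₂ (witness v)))))
    where
    witness : ∀ v → ∃ λ h → a h ≡ suc v
    witness v with conn (suc v) zero
    ... | (h , e , _) ◅ _ = h , e

maps-complete : ∀ {n} (m : Map n) → Any (Iso m) (maps n)
maps-complete {n} m =
  Any.concatMap⁺ (mapsWithVertices n)
    (Any.map (λ { refl → found }) (∈-upTo⁺ (s≤s (#vertices-bound m))))
  where
  found : Any (Iso m) (mapsWithVertices n (#vertices m))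
  found =
    Any.concatMap⁺ mapsWithIncidence (Any.map (λ {a} p →
      Any.concatMap⁺ (asMap a) (Any.map (λ q → asMap-complete m p q)
        (∈-halfEdgeFunctions ∈-halfEdges (next m))))
      (∈-halfEdgeFunctions ∈-allFin (vertexOf m)))

aloneAt : ∀ {n} (m : Map n) → Vertex m → List (Corner m)
aloneAt m v with allHalfEdges? (λ h → ¬? (vertexOf m h Fin.≟ v))
... | yes p = [ alone v p ]
... | no _  = []

corners : ∀ {n} (m : Map n) → List (Corner m)
corners {n} m = map after (halfEdges n) ++ concatMap (aloneAt m) (allFin _)

corners-complete : ∀ {n} {m m′ : Map n} (i : Iso m m′) (c : Corner m) →
                   Any (CornerImage (onHalfEdge i) (onVertex i) c) (corners m′)
corners-complete i (after h) = Any.++⁺ˡ (Any.map⁺ (∈-halfEdges (onHalfEdge i h)))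
corners-complete {m = m} {m′} i (alone v p) =
  Any.++⁺ʳ (map after (halfEdges _)) (Any.concatMap⁺ (aloneAt _) (Any.map
    (λ { refl → found }) (∈-allFin (onVertex i v))))
  where
  found : Any (CornerImage (onHalfEdge i) (onVertex i) (alone v p)) (aloneAt m′ (onVertex i v))
  found with allHalfEdges? (λ h → ¬? (vertexOf m′ h Fin.≟ onVertex i v))
  ... | yes _ = here refl
  ... | no ¬q = contradiction
    (λ h e → p (onHalfEdge (Iso-sym i) h)
      (trans (vertexOf-iso (Iso-sym i) h)
        (trans (cong (onVertex (Iso-sym i)) e) (Inverse.strictlyInverseʳ (vertices i) v))))
    ¬q

rootings : ∀ {n} → Map n → List (RootedMap n)
rootings m = map (m rootedAt_) (corners m)

labelledRootedMaps : ∀ n → List (RootedMap n)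
labelledRootedMaps n = concatMap rootings (maps n)

labelledRootedMaps-complete : ∀ n → IsEnumeration (rootedMapSetoid n) (labelledRootedMaps n)
labelledRootedMaps-complete n M =
  Any.concatMap⁺ rootings (Any.map
    (λ i → Any.map⁺ (Any.map (λ r → record { iso = i ; root-iso = r }) (corners-complete i (root M))))
    (maps-complete (mapOf M)))

abstract
  rootedMaps : ∀ n → List (RootedMap n)
  rootedMaps n = deduplicate _≅?_ (labelledRootedMaps n)

  rootedMaps-complete : ∀ n → IsEnumeration (rootedMapSetoid n) (rootedMaps n)
  rootedMaps-complete n M =
    Membershipₛ.∈-deduplicate⁺ (rootedMapSetoid n) _≅?_
      (λ p q → ≅-trans q (≅-sym p)) (labelledRootedMaps-complete n M)

  rootedMaps-unique : ∀ n → Unique (rootedMapSetoid n) (rootedMaps n)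
  rootedMaps-unique n = deduplicate-! (rootedMapDecSetoid n) (labelledRootedMaps n)

-- One vertex carrying n loops.

bouquet : ∀ n → RootedMap n
bouquet zero = record
  { #vertices     = 1
  ; vertexOf      = λ _ → zero
  ; next          = id
  ; next-vertexOf = λ _ → refl
  ; next-cyclic   = λ { (() , _) }
  ; connected     = λ { zero zero → Star.ε }
  } rootedAt alone zero λ { (() , _) }
bouquet (suc n) = record
  { #vertices     = 1
  ; vertexOf      = λ _ → zero
  ; next          = turn
  ; next-vertexOf = λ _ → refl
  ; next-cyclic   = λ h h′ _ → down h ◅◅ refl ◅ up h′
  ; connected     = λ { zero zero → Star.ε }
  } rootedAt after (zero , false)
  where
  turn : HalfEdge (suc n) → HalfEdge (suc n)
  turn (e , true)      = e , false
  turn (zero , false)  = fromℕ n , true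
  turn (suc e , false) = inject₁ e , true

  Turns : Rel (HalfEdge (suc n)) 0ℓ
  Turns = Star (λ x y → turn x ≡ y)

  down : ∀ h → Turns h (zero , false)
  down (e , true)  = refl ◅ down (e , false)
  down (e , false) = <-weakInduction (λ e → Turns (e , false) (zero , false))
    Star.ε (λ _ p → refl ◅ refl ◅ p) e

  up : ∀ h → Turns (fromℕ n , true) h
  up (e , true)  = >-weakInduction (λ e → Turns (fromℕ n , true) (e , true))
    Star.ε (λ _ p → p ◅◅ refl ◅ refl ◅ Star.ε) e
  up (e , false) = up (e , true) ◅◅ refl ◅ Star.ε

rootedMaps-nonEmpty : ∀ n → NonZero (length (rootedMaps n))
rootedMaps-nonEmpty n with rootedMaps n | rootedMaps-complete n (bouquet n)
... | _ ∷ _ | _ = _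

record ℝ : Set where
  field
    seq    : ℕ → ℚ
    cauchy : ∀ ε → 0ℚ < ε → ∃ λ N → ∀ i j → N ℕ.≤ i → N ℕ.≤ j → ∣ seq i - seq j ∣ < ε

open ℝ public

fromℚ : ℚ → ℝ
fromℚ q = record
  { seq    = λ _ → q
  ; cauchy = λ ε 0<ε → 0 , λ _ _ _ _ → subst (_< ε) (sym (cong ∣_∣ (ℚ.+-inverseʳ q))) 0<ε
  }

0<½* : ∀ {ε} → 0ℚ < ε → 0ℚ < ℚ.½ * ε
0<½* {ε} 0<ε = subst (_< ℚ.½ * ε) (ℚ.*-zeroʳ ℚ.½) (ℚ.*-monoʳ-<-pos ℚ.½ 0<ε)

½+½ : ∀ ε → ℚ.½ * ε + ℚ.½ * ε ≡ ε
½+½ ε = trans (sym (ℚ.*-distribʳ-+ ε ℚ.½ ℚ.½)) (ℚ.*-identityˡ ε)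

infixl 6 _+ᵣ_
_+ᵣ_ : ℝ → ℝ → ℝ
x +ᵣ y = record { seq = λ i → seq x i + seq y i ; cauchy = bound }
  where
  open +-*-Solver
  regroup : ∀ a b c d → (a + b) - (c + d) ≡ (a - c) + (b - d)
  regroup = solve 4 (λ a b c d → (a :+ b) :- (c :+ d) := (a :- c) :+ (b :- d)) refl

  bound : ∀ ε → 0ℚ < ε → ∃ λ N → ∀ i j → N ℕ.≤ i → N ℕ.≤ j →
          ∣ (seq x i + seq y i) - (seq x j + seq y j) ∣ < ε
  bound ε 0<ε with cauchy x (ℚ.½ * ε) (0<½* 0<ε) | cauchy y (ℚ.½ * ε) (0<½* 0<ε)
  ... | N₁ , p | N₂ , q = N₁ ℕ.⊔ N₂ , λ i j N≤i N≤j →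
    subst₂ _<_ (cong ∣_∣ (sym (regroup (seq x i) (seq y i) (seq x j) (seq y j)))) (½+½ ε)
      (ℚ.≤-<-trans (ℚ.∣p+q∣≤∣p∣+∣q∣ (seq x i - seq x j) (seq y i - seq y j))
        (ℚ.+-mono-<
          (p i j (ℕ.≤-trans (ℕ.m≤m⊔n N₁ N₂) N≤i) (ℕ.≤-trans (ℕ.m≤m⊔n N₁ N₂) N≤j))
          (q i j (ℕ.≤-trans (ℕ.m≤n⊔m N₁ N₂) N≤i) (ℕ.≤-trans (ℕ.m≤n⊔m N₁ N₂) N≤j))))

infixl 7 _·_
_·_ : ℚ → ℝ → ℝ
q · x = record { seq = λ i → q * seq x i ; cauchy = bound }
  where
  c : ℚ
  c = 1ℚ + ∣ q ∣

  instance
    c-positive : Positive c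
    c-positive = ℚ.pos+nonNeg⇒pos 1ℚ ∣ q ∣ {{ℚ.∣-∣-nonNeg q}}

    c-nonZero : ℚ.NonZero c
    c-nonZero = ℚ.pos⇒nonZero c

    1/c-positive : Positive (1/ c)
    1/c-positive = ℚ.1/pos⇒pos c

  q≤c : ∣ q ∣ ≤ c
  q≤c = subst (_≤ c) (ℚ.+-identityˡ ∣ q ∣) (ℚ.+-monoˡ-≤ ∣ q ∣ (ℚ.nonNegative⁻¹ 1ℚ))

  cancel : ∀ ε → c * (1/ c * ε) ≡ ε
  cancel ε = trans (sym (ℚ.*-assoc c (1/ c) ε))
    (trans (cong (_* ε) (ℚ.*-inverseʳ c)) (ℚ.*-identityˡ ε))

  open +-*-Solver
  factor : ∀ q a b → q * (a - b) ≡ q * a - q * b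
  factor = solve 3 (λ q a b → q :* (a :- b) := q :* a :- q :* b) refl

  bound : ∀ ε → 0ℚ < ε → ∃ λ N → ∀ i j → N ℕ.≤ i → N ℕ.≤ j → ∣ q * seq x i - q * seq x j ∣ < ε
  bound ε 0<ε
    with cauchy x (1/ c * ε) (subst (_< 1/ c * ε) (ℚ.*-zeroʳ (1/ c)) (ℚ.*-monoʳ-<-pos (1/ c) 0<ε))
  ... | N , p = N , λ i j N≤i N≤j → let d = seq x i - seq x j in
    subst₂ _<_ (trans (sym (ℚ.∣p*q∣≡∣p∣*∣q∣ q d)) (cong ∣_∣ (factor q (seq x i) (seq x j)))) (cancel ε)
      (ℚ.≤-<-trans (ℚ.*-monoʳ-≤-nonNeg ∣ d ∣ {{ℚ.∣-∣-nonNeg d}} q≤c)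
        (ℚ.*-monoʳ-<-pos c (p i j N≤i N≤j)))

-- For Cauchy sequences ∣ x - y ∣ < ε implies x ≈[ ε ] y, which in turn
-- implies ∣ x - y ∣ ≤ ε.

_≈[_]_ : ℝ → ℚ → ℝ → Set
x ≈[ ε ] y = ∃ λ N → ∀ i → N ℕ.≤ i → ∣ seq x i - seq y i ∣ < ε

_⟶_ : (ℕ → ℝ) → ℝ → Set
u ⟶ x = ∀ ε → 0ℚ < ε → ∃ λ N → ∀ n → N ℕ.≤ n → u n ≈[ ε ] x

e⁻¹-term : ℕ → ℚ
e⁻¹-term i = ((-1ℤ ℤ.^ i) / (i !)) {{i ℕ.!≢0}}

e⁻¹-partial : ℕ → ℚ
e⁻¹-partial zero    = 0ℚ
e⁻¹-partial (suc i) = e⁻¹-partial i + e⁻¹-term i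

1/!_ : ℕ → ℚ
1/! i = (1ℤ / (i !)) {{i ℕ.!≢0}}

-1^ : ∀ i → (-1ℤ ℤ.^ i ≡ 1ℤ) ⊎ (-1ℤ ℤ.^ i ≡ -1ℤ)
-1^ zero    = inj₁ refl
-1^ (suc i) with -1^ i
... | inj₁ p = inj₂ (cong (-1ℤ ℤ.*_) p)
... | inj₂ p = inj₁ (cong (-1ℤ ℤ.*_) p)

toℚᵘ-/ : ∀ i n .{{_ : NonZero n}} → toℚᵘ (i / n) ℚᵘ.≃ (i ℚᵘ./ n)
toℚᵘ-/ i (suc n) = ℚ.toℚᵘ-fromℚᵘ (ℚᵘ.mkℚᵘ i n)

0≤1/ : ∀ n .{{_ : NonZero n}} → 0ℚ ≤ 1ℤ / n
0≤1/ n@(suc _) = ℚ.nonNegative⁻¹ (1ℤ / n) {{ℚ.normalize-nonNeg 1 n}}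

1/-antimono : ∀ m n .{{_ : NonZero m}} .{{_ : NonZero n}} → m ℕ.≤ n → 1ℤ / n ≤ 1ℤ / m
1/-antimono m@(suc _) n@(suc _) m≤n = ℚ.toℚᵘ-cancel-≤
  (ℚᵘ.≤-respʳ-≃ (ℚᵘ.≃-sym (toℚᵘ-/ 1ℤ m)) (ℚᵘ.≤-respˡ-≃ (ℚᵘ.≃-sym (toℚᵘ-/ 1ℤ n))
    (ℚᵘ.*≤* (ℤ.*-monoˡ-≤-nonNeg 1ℤ (ℤ.+≤+ m≤n)))))

1/2n+1/2n : ∀ n .{{_ : NonZero n}} .{{_ : NonZero (n ℕ.+ n)}} →
            1ℤ / (n ℕ.+ n) + 1ℤ / (n ℕ.+ n) ≡ 1ℤ / n
1/2n+1/2n n@(suc _) = ℚ.toℚᵘ-injective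
  (ℚᵘ.≃-trans (ℚ.toℚᵘ-homo-+ (1ℤ / (n ℕ.+ n)) (1ℤ / (n ℕ.+ n)))
    (ℚᵘ.≃-trans (ℚᵘ.+-cong (toℚᵘ-/ 1ℤ (n ℕ.+ n)) (toℚᵘ-/ 1ℤ (n ℕ.+ n)))
      (ℚᵘ.≃-trans (ℚᵘ.*≡* (cong +_ (lemma n))) (ℚᵘ.≃-sym (toℚᵘ-/ 1ℤ n)))))
  where
  open ℕS.+-*-Solver
  lemma : ∀ n → (1 ℕ.* (n ℕ.+ n) ℕ.+ 1 ℕ.* (n ℕ.+ n)) ℕ.* n ≡ 1 ℕ.* ((n ℕ.+ n) ℕ.* (n ℕ.+ n))
  lemma = solve 1 (λ n → (con 1 :* (n :+ n) :+ con 1 :* (n :+ n)) :* n :=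
                         con 1 :* ((n :+ n) :* (n :+ n))) refl

∣term∣ : ∀ i → ∣ e⁻¹-term i ∣ ≡ 1/! i
∣term∣ i with -1ℤ ℤ.^ i | -1^ i
... | _ | inj₁ refl = ℚ.0≤p⇒∣p∣≡p (0≤1/ (i !) {{i ℕ.!≢0}})
... | _ | inj₂ refl = trans (ℚ.∣-p∣≡∣p∣ (1/! i)) (ℚ.0≤p⇒∣p∣≡p (0≤1/ (i !) {{i ℕ.!≢0}}))

halving : ∀ i → 1/! (suc (suc i)) + 1/! (suc (suc i)) ≤ 1/! (suc i)
halving i = ℚ.≤-trans (ℚ.+-mono-≤ step step) (ℚ.≤-reflexive (1/2n+1/2n f))
  where
  f : ℕ
  f = suc i !
  instance
    f≢0 : NonZero f
    f≢0 = suc i ℕ.!≢0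
    ff≢0 : NonZero (f ℕ.+ f)
    ff≢0 = ℕ.>-nonZero (ℕ.<-≤-trans (ℕ.>-nonZero⁻¹ f) (ℕ.m≤m+n f f))
  step : 1/! (suc (suc i)) ≤ 1ℤ / (f ℕ.+ f)
  step = 1/-antimono (f ℕ.+ f) (suc (suc i) !) {{ff≢0}} {{suc (suc i) ℕ.!≢0}}
    (ℕ.+-monoʳ-≤ f (ℕ.m≤m+n f (i ℕ.* f)))

tail-bound : ∀ k i → ∣ e⁻¹-partial (k ℕ.+ suc i) - e⁻¹-partial (suc i) ∣ +
                     (1/! (k ℕ.+ suc i) + 1/! (k ℕ.+ suc i)) ≤ 1/! (suc i) + 1/! (suc i)
tail-bound zero i = ℚ.≤-reflexive
  (trans (cong (λ d → ∣ d ∣ + u) (ℚ.+-inverseʳ (e⁻¹-partial (suc i)))) (ℚ.+-identityˡ u))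
  where u = 1/! (suc i) + 1/! (suc i)
tail-bound (suc k) i = begin
  ∣ (s + t) - s₀ ∣ + (r′ + r′)   ≡⟨ cong (λ d → ∣ d ∣ + (r′ + r′)) (regroup s t s₀) ⟩
  ∣ (s - s₀) + t ∣ + (r′ + r′)   ≤⟨ ℚ.+-mono-≤ (ℚ.∣p+q∣≤∣p∣+∣q∣ (s - s₀) t) r′+r′≤r ⟩
  (∣ s - s₀ ∣ + ∣ t ∣) + r       ≡⟨ cong (λ x → (∣ s - s₀ ∣ + x) + r) (∣term∣ j) ⟩
  (∣ s - s₀ ∣ + r) + r           ≡⟨ ℚ.+-assoc ∣ s - s₀ ∣ r r ⟩
  ∣ s - s₀ ∣ + (r + r)           ≤⟨ tail-bound k i ⟩
  1/! (suc i) + 1/! (suc i)      ∎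
  where
  open ℚ.≤-Reasoning
  j  = k ℕ.+ suc i
  s  = e⁻¹-partial j
  s₀ = e⁻¹-partial (suc i)
  t  = e⁻¹-term j
  r  = 1/! j
  r′ = 1/! (suc j)
  r′+r′≤r : r′ + r′ ≤ r
  r′+r′≤r = subst (λ j → 1/! (suc j) + 1/! (suc j) ≤ 1/! j)
    (sym (ℕ.+-suc k i)) (halving (k ℕ.+ i))
  regroup : ∀ s t s₀ → (s + t) - s₀ ≡ (s - s₀) + t
  regroup = solve 3 (λ s t s₀ → (s :+ t) :- s₀ := (s :- s₀) :+ t) refl
    where open +-*-Solver

n≤n! : ∀ n → n ℕ.≤ n !
n≤n! zero    = z≤n
n≤n! (suc n) = ℕ.≤-trans (ℕ.≤-reflexive (sym (ℕ.*-identityʳ (suc n))))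
  (ℕ.*-monoʳ-≤ (suc n) (ℕ.>-nonZero⁻¹ (n !) {{n ℕ.!≢0}}))

archimedean : ∀ ε → 0ℚ < ε → ∃ λ d → 1ℤ / suc d ≤ ε
archimedean ε@(ℚ.mkℚ (+ suc p) d _) _ = d , ℚ.toℚᵘ-cancel-≤
  (ℚᵘ.≤-respˡ-≃ (ℚᵘ.≃-sym (toℚᵘ-/ 1ℤ (suc d)))
    (ℚᵘ.*≤* (ℤ.*-monoʳ-≤-nonNeg (+ suc d) {+ 1} {+ suc p} (ℤ.+≤+ (s≤s z≤n)))))
archimedean (ℚ.mkℚ (+ zero) d _)   (ℚ.*<* (ℤ.+<+ ()))
archimedean (ℚ.mkℚ -[1+ p ] d _)   (ℚ.*<* ())

e⁻¹-cauchy-≤ : ∀ d i j → suc (d ℕ.+ suc d) ℕ.≤ i → i ℕ.≤ j →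
               ∣ e⁻¹-partial j - e⁻¹-partial i ∣ < 1ℤ / suc d
e⁻¹-cauchy-≤ d (suc i) j D≤i i≤j =
  ℚ.<-≤-trans (subst (_< u) (ℚ.+-identityʳ Δ) (ℚ.+-monoʳ-< Δ 0<v))
    (ℚ.≤-trans Δ+v≤u u≤1/d)
  where
  k = j ℕ.∸ suc i
  Δ = ∣ e⁻¹-partial j - e⁻¹-partial (suc i) ∣
  v = 1/! j + 1/! j
  u = Δ + v

  0<v : 0ℚ < v
  0<v = ℚ.positive⁻¹ v {{ℚ.pos+pos⇒pos (1/! j) (1/! j)}}
    where
    instance
      positive : Positive (1/! j)
      positive = ℚ.normalize-pos 1 (j !) {{j ℕ.!≢0}}

  Δ+v≤u : u ≤ 1/! (suc i) + 1/! (suc i)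
  Δ+v≤u = subst
    (λ j → ∣ e⁻¹-partial j - e⁻¹-partial (suc i) ∣ + (1/! j + 1/! j) ≤ 1/! (suc i) + 1/! (suc i))
    (ℕ.m∸n+n≡m i≤j) (tail-bound k i)

  step : 1/! (suc i) ≤ 1ℤ / (suc d ℕ.+ suc d)
  step = 1/-antimono (suc d ℕ.+ suc d) (suc i !) {{_}} {{suc i ℕ.!≢0}}
    (ℕ.≤-trans D≤i (n≤n! (suc i)))

  u≤1/d : 1/! (suc i) + 1/! (suc i) ≤ 1ℤ / suc d
  u≤1/d = ℚ.≤-trans (ℚ.+-mono-≤ step step) (ℚ.≤-reflexive (1/2n+1/2n (suc d)))

∣-∣-sym : ∀ p q → ∣ p - q ∣ ≡ ∣ q - p ∣
∣-∣-sym p q = trans (cong ∣_∣ (swap p q)) (ℚ.∣-p∣≡∣p∣ (q - p))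
  where
  open +-*-Solver
  swap : ∀ p q → p - q ≡ - (q - p)
  swap = solve 2 (λ p q → p :- q := :- (q :- p)) refl

e⁻¹ : ℝ
e⁻¹ = record { seq = e⁻¹-partial ; cauchy = bound }
  where
  bound : ∀ ε → 0ℚ < ε → ∃ λ N → ∀ i j → N ℕ.≤ i → N ℕ.≤ j →
          ∣ e⁻¹-partial i - e⁻¹-partial j ∣ < ε
  bound ε 0<ε with archimedean ε 0<ε
  ... | d , 1/d≤ε = suc (d ℕ.+ suc d) , close
    where
    close : ∀ i j → suc (d ℕ.+ suc d) ℕ.≤ i → suc (d ℕ.+ suc d) ℕ.≤ j →
            ∣ e⁻¹-partial i - e⁻¹-partial j ∣ < ε
    close i j N≤i N≤j with ℕ.≤-total i j
    ... | inj₁ i≤j = subst (_< ε) (∣-∣-sym (e⁻¹-partial j) (e⁻¹-partial i))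
                       (ℚ.<-≤-trans (e⁻¹-cauchy-≤ d i j N≤i i≤j) 1/d≤ε)
    ... | inj₂ j≤i = ℚ.<-≤-trans (e⁻¹-cauchy-≤ d j i N≤j j≤i) 1/d≤ε

-- Laws on ℕ, given by their mass functions k ↦ P(X = k).

Law : Set
Law = ℕ → ℝ

sumTo : (ℕ → ℝ) → ℕ → ℝ
sumTo p zero    = p 0
sumTo p (suc k) = sumTo p k +ᵣ p (suc k)

-- P(X ≤ x): the natural numbers k ≤ x are those with k ≤ floor x.

cdf : Law → ℚ → ℝ
cdf p x with floor x
... | + k      = sumTo p k
... | -[1+ _ ] = fromℚ 0ℚ

ContinuousAt : (ℚ → ℝ) → ℚ → Set
ContinuousAt F x =
  ∀ ε → 0ℚ < ε → ∃ λ δ → 0ℚ < δ × (∀ y → ∣ y - x ∣ < δ → F y ≈[ ε ] F x)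

-- Distribution functions of laws on ℕ are constant between consecutive
-- integers, so it is enough to consider rational points x.

ConvergesInDistribution : (ℕ → Law) → Law → Set
ConvergesInDistribution p q =
  ∀ x → ContinuousAt (cdf q) x → (λ n → cdf (p n) x) ⟶ cdf q x

poisson₁ : Law
poisson₁ k = (1ℤ / (k !)) {{k ℕ.!≢0}} · e⁻¹

uniformLaw : ∀ {A : Set} (xs : List A) .{{_ : NonZero (length xs)}} → (A → ℕ) → Law
uniformLaw xs f k = fromℚ (+ length (filter (λ x → f x ℕ.≟ k) xs) / length xs)

-- rootedMaps n contains exactly one representative of each isomorphism
-- class, so a uniform entry of it is a uniform rooted map.

leafLaw : ℕ → Law
leafLaw n = uniformLaw (rootedMaps n) {{rootedMaps-nonEmpty n}} (#leaves ∘ mapOf)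

{-# OPTIONS --safe #-}

-- Give the 2n half-edges of a rooted map with n edges labels for which
-- opposite is a fixed involution.  The map becomes a permutation (turning
-- around the vertices) that together with opposite acts transitively, plus
-- a root half-edge.  A rooted map has no nontrivial automorphism, so all of
-- them have the same number of labellings, and the leaves are the fixed
-- points of the permutation.  Hence the leaf law is the law of the number of
-- fixed points of a uniform permutation of 2n elements, conditioned on
-- transitivity.
--
-- Without conditioning, P(k fixed points) is exactly
-- (1/k!) ∑_{i ≤ 2n-k} (-1)^i / i!.  The probability of intransitivity is O(1/n):
-- it is at most the sum over the proper nonempty sets of edges, with s edges
-- inside and t outside, of (2s)! (2t)! / (2n)!.

module Submission where

open import Defs

open import Data.Bool.Base using (Bool; true; false; if_then_else_)
import Data.Bool.Properties as Bool
open import Data.Fin.Base using (Fin; zero; suc; punchOut)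
import Data.Fin.Properties as Fin
open import Data.Integer.Base as ℤ using (-[1+_]; 1ℤ; -1ℤ) renaming (+_ to pos)
import Data.Integer.Properties as ℤ
open import Data.List.Base
  using (List; []; _∷_; [_]; _++_; length; filter; allFin; map; tabulate;
         cartesianProduct; cartesianProductWith)
open import Data.List.Membership.Propositional using (_∈_)
open import Data.List.Membership.Propositional.Properties
  using (∈-allFin; ∈-cartesianProduct⁺; ∈-cartesianProductWith⁺; ∈-filter⁺)
open import Data.List.Properties using (length-tabulate; length-filter)
open import Data.List.Relation.Unary.All as All using ([]; _∷_)
open import Data.List.Relation.Unary.AllPairs as AllPairs using (AllPairs; []; _∷_)
open import Data.List.Relation.Unary.Any as Any using (Any; here; there; any?)
open import Data.List.Relation.Unary.Unique.Propositional using (Unique)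
import Data.List.Relation.Unary.Unique.Propositional.Properties as Unique
open import Data.Nat.Base
  using (ℕ; zero; suc; _+_; _*_; _∸_; _≤_; _<_; _>_; z≤n; s≤s; NonZero; _!; >-nonZero⁻¹)
open import Data.Nat.Properties
open import Data.Nat.Solver using (module +-*-Solver)
open import Data.Product.Base using (∃; _×_; _,_; proj₁; proj₂; map₁)
open import Data.Rational.Base as ℚ
  using (ℚ; 0ℚ; 1ℚ; ½; _/_; ∣_∣; floor)
  renaming (_+_ to _+ℚ_; _-_ to _-ℚ_; _*_ to _*ℚ_; -_ to -ℚ_; _≤_ to _≤ℚ_; _<_ to _<ℚ_)
import Data.Rational.Properties as ℚ
import Data.Rational.Solver as ℚ
import Data.Rational.Unnormalised.Base as ℚᵘ
import Data.Rational.Unnormalised.Properties as ℚᵘ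
open import Data.Sum.Base using (_⊎_; inj₁; inj₂)
open import Data.Vec.Base as Vec using (Vec; []; _∷_; lookup)
open import Data.Vec.Properties using (lookup∘tabulate)
open import Function.Base using (_∘_; id)
open import Function.Bundles using (_↔_; mk↔ₛ′; mk⇔; Inverse)
open import Function.Definitions using (Injective)
open import Function.Properties.Inverse using (↔-sym; ↔-trans)
open import Relation.Binary.Construct.Closure.ReflexiveTransitive as Star
  using (Star; _◅_; _◅◅_)
open import Relation.Binary.PropositionalEquality
  using (_≡_; _≢_; refl; sym; trans; cong; cong₂; subst; subst₂; module ≡-Reasoning)
open import Relation.Nullary.Decidable
  using (Dec; yes; no; does; map′; ¬?; does-⇔; dec-true; dec-false; decidable-stable;
         _×-dec_; _⊎-dec_)
open import Relation.Nullary.Negation using (¬_; contradiction)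
open import Relation.Unary using (Decidable)

-- Orbits, stabilisers and quotients never appear; all counts are finite sums of indicators.
-- `Relabels` relates pairs (g, M) to pairs (p, r): (g, M) has exactly one partner if g commutes
-- with `opposite` and none otherwise, and (p, r) has exactly one if p is transitive and none
-- otherwise. Counting related pairs with a weight that depends on the number of leaves gives the
-- numerator and the denominator of the leaf law at once, up to a common factor. Permutations are
-- insertion codes, so that fixed points, cycles (the vertices) and invariant colourings are all
-- counted by induction on the inserted element. The sum of (2s)! (2t)! is bounded by a recursion
-- rather than through binomial coefficients. With n = s + t, a new edge replaces a nonzero term by
-- two whose sum is at most 4n^2 - 2n + 12 times as large, with equality when one part is a single
-- edge. The empty and the full set become proper and add 4 (2n)!. Since (2n)! itself grows by the
-- factor 4n^2 + 6n + 2, the quotient by (2n)! is O(1/n).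

private variable
  X Y Z : Set
  Φ Ψ : Set

-- Indicators and finite sums

𝟙 : Dec Φ → ℕ
𝟙 d = if does d then 1 else 0

𝟙-yes : (d : Dec Φ) → Φ → 𝟙 d ≡ 1
𝟙-yes (yes _) _ = refl
𝟙-yes (no ¬p) p = contradiction p ¬p

𝟙-no : (d : Dec Φ) → ¬ Φ → 𝟙 d ≡ 0
𝟙-no (yes p) ¬p = contradiction p ¬p
𝟙-no (no _)  _  = refl

𝟙-≤ : (d : Dec Φ) {a : ℕ} → (Φ → 1 ≤ a) → 𝟙 d ≤ a
𝟙-≤ (yes p) f = f p
𝟙-≤ (no _)  f = z≤n

𝟙-mono : (d : Dec Φ) (e : Dec Ψ) → (Φ → Ψ) → 𝟙 d ≤ 𝟙 e
𝟙-mono d e f = 𝟙-≤ d (λ p → ≤-reflexive (sym (𝟙-yes e (f p))))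

𝟙-cong : (d : Dec Φ) (e : Dec Ψ) → (Φ → Ψ) → (Ψ → Φ) → 𝟙 d ≡ 𝟙 e
𝟙-cong d e f g = ≤-antisym (𝟙-mono d e f) (𝟙-mono e d g)

𝟙-*-cong : (d : Dec Φ) {a b : ℕ} → (Φ → a ≡ b) → 𝟙 d * a ≡ 𝟙 d * b
𝟙-*-cong (yes p) f = cong (_+ 0) (f p)
𝟙-*-cong (no _)  f = refl

∑ : List X → (X → ℕ) → ℕ
∑ []       f = 0
∑ (x ∷ xs) f = f x + ∑ xs f

infix 5 ∑
syntax ∑ xs (λ x → e) = ∑[ x ∈ xs ] e

∑-cong : ∀ (xs : List X) {f g : X → ℕ} → (∀ x → f x ≡ g x) → ∑ xs f ≡ ∑ xs g
∑-cong []       f≡g = refl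
∑-cong (x ∷ xs) f≡g = cong₂ _+_ (f≡g x) (∑-cong xs f≡g)

∑-mono : ∀ (xs : List X) {f g : X → ℕ} → (∀ x → f x ≤ g x) → ∑ xs f ≤ ∑ xs g
∑-mono []       f≤g = z≤n
∑-mono (x ∷ xs) f≤g = +-mono-≤ (f≤g x) (∑-mono xs f≤g)

interchange : ∀ a b c d → (a + b) + (c + d) ≡ (a + c) + (b + d)
interchange = solve 4 (λ a b c d → (a :+ b) :+ (c :+ d) := (a :+ c) :+ (b :+ d)) refl
  where open +-*-Solver

∑-+ : ∀ (xs : List X) (f g : X → ℕ) → ∑[ x ∈ xs ] (f x + g x) ≡ ∑ xs f + ∑ xs g
∑-+ []       f g = refl
∑-+ (x ∷ xs) f g =
  trans (cong (f x + g x +_) (∑-+ xs f g)) (interchange (f x) (g x) (∑ xs f) (∑ xs g))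

∑-*ˡ : ∀ (xs : List X) c (f : X → ℕ) → ∑[ x ∈ xs ] (c * f x) ≡ c * ∑ xs f
∑-*ˡ []       c f = sym (*-zeroʳ c)
∑-*ˡ (x ∷ xs) c f = trans (cong (c * f x +_) (∑-*ˡ xs c f)) (sym (*-distribˡ-+ c (f x) (∑ xs f)))

∑-*ʳ : ∀ (xs : List X) c (f : X → ℕ) → ∑[ x ∈ xs ] (f x * c) ≡ ∑ xs f * c
∑-*ʳ xs c f = trans (∑-cong xs (λ x → *-comm (f x) c)) (trans (∑-*ˡ xs c f) (*-comm c (∑ xs f)))

∑-const : ∀ (xs : List X) c → ∑[ _ ∈ xs ] c ≡ length xs * c
∑-const []       c = refl
∑-const (x ∷ xs) c = cong (c +_) (∑-const xs c)

∑-swap : ∀ (xs : List X) (ys : List Y) (f : X → Y → ℕ) →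
         ∑[ x ∈ xs ] ∑[ y ∈ ys ] f x y ≡ ∑[ y ∈ ys ] ∑[ x ∈ xs ] f x y
∑-swap []       ys f = sym (trans (∑-const ys 0) (*-zeroʳ (length ys)))
∑-swap (x ∷ xs) ys f = trans (cong (∑ ys (f x) +_) (∑-swap xs ys f)) (sym (∑-+ ys (f x) _))

∑-++ : ∀ (xs ys : List X) f → ∑ (xs ++ ys) f ≡ ∑ xs f + ∑ ys f
∑-++ []       ys f = refl
∑-++ (x ∷ xs) ys f = trans (cong (f x +_) (∑-++ xs ys f)) (sym (+-assoc (f x) (∑ xs f) (∑ ys f)))

∑-map : ∀ (g : X → Y) xs f → ∑ (map g xs) f ≡ ∑ xs (f ∘ g)
∑-map g []       f = refl
∑-map g (x ∷ xs) f = cong (f (g x) +_) (∑-map g xs f)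

∑-cartesianProductWith : ∀ (_⊗_ : X → Y → Z) xs ys f →
  ∑ (cartesianProductWith _⊗_ xs ys) f ≡ ∑[ x ∈ xs ] ∑[ y ∈ ys ] f (x ⊗ y)
∑-cartesianProductWith _⊗_ []       ys f = refl
∑-cartesianProductWith _⊗_ (x ∷ xs) ys f =
  trans (∑-++ (map (x ⊗_) ys) _ f)
    (cong₂ _+_ (∑-map (x ⊗_) ys f) (∑-cartesianProductWith _⊗_ xs ys f))

∑-tabulate : ∀ {n} (g : Fin n → X) (f : X → ℕ) → ∑ (tabulate g) f ≡ ∑ (allFin n) (f ∘ g)
∑-tabulate {n = zero}  g f = refl
∑-tabulate {n = suc n} g f = cong (f (g zero) +_)
  (trans (∑-tabulate (g ∘ suc) f) (sym (∑-tabulate suc (f ∘ g))))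

∑-allFin-suc : ∀ n (f : Fin (suc n) → ℕ) → ∑ (allFin (suc n)) f ≡ f zero + ∑ (allFin n) (f ∘ suc)
∑-allFin-suc n f = cong (f zero +_) (∑-tabulate suc f)

length-filter-∑ : {Φ : X → Set} (Φ? : Decidable Φ) (xs : List X) →
                length (filter Φ? xs) ≡ ∑[ x ∈ xs ] 𝟙 (Φ? x)
length-filter-∑ Φ? []       = refl
length-filter-∑ Φ? (x ∷ xs) with does (Φ? x)
... | true  = cong suc (length-filter-∑ Φ? xs)
... | false = length-filter-∑ Φ? xs

∑-∈ : ∀ (f : X → ℕ) {x xs} → x ∈ xs → f x ≤ ∑ xs f
∑-∈ f {xs = _ ∷ xs} (here refl) = m≤m+n _ (∑ xs f)
∑-∈ f {xs = y ∷ xs} (there x∈)  = ≤-trans (∑-∈ f x∈) (m≤n+m _ (f y))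

-- Pairwise exclusion leaves at most one nonzero term. In this form a uniqueness statement becomes a
-- count.
∑-≤1 : {Φ : X → Set} (Φ? : Decidable Φ) {xs : List X} → AllPairs (λ x y → ¬ (Φ x × Φ y)) xs →
       ∑[ x ∈ xs ] 𝟙 (Φ? x) ≡ 𝟙 (any? Φ? xs)
∑-≤1 Φ? [] = refl
∑-≤1 Φ? {x ∷ xs} (¬xs ∷ ps) with Φ? x
... | no  _ = ∑-≤1 Φ? ps
... | yes p = cong suc (trans (∑-≤1 Φ? ps) (𝟙-no (any? Φ? xs)
  (λ q → All.lookupWith (λ ¬pq q → ¬pq (p , q)) ¬xs q)))

∑-≡1 : {Φ : X → Set} (Φ? : Decidable Φ) {xs : List X} → AllPairs (λ x y → ¬ (Φ x × Φ y)) xs →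
       Any Φ xs → ∑[ x ∈ xs ] 𝟙 (Φ? x) ≡ 1
∑-≡1 Φ? {xs} ps p = trans (∑-≤1 Φ? ps) (𝟙-yes (any? Φ? xs) p)

-- Both sides add up weights over all related pairs; relatedness allows the weight of one end to be
-- traded for that of the other.
doubleCounting : {R : X → Y → Set} (R? : ∀ x y → Dec (R x y)) {u : X → ℕ} {v : Y → ℕ} →
  (∀ {x y} → R x y → u x ≡ v y) → ∀ xs ys →
  ∑[ x ∈ xs ] (∑[ y ∈ ys ] 𝟙 (R? x y)) * u x ≡ ∑[ y ∈ ys ] (∑[ x ∈ xs ] 𝟙 (R? x y)) * v y
doubleCounting R? {u} {v} u≡v xs ys = begin
  ∑[ x ∈ xs ] (∑[ y ∈ ys ] 𝟙 (R? x y)) * u x  ≡⟨ ∑-cong xs (λ x → sym (∑-*ʳ ys (u x) _)) ⟩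
  ∑[ x ∈ xs ] ∑[ y ∈ ys ] 𝟙 (R? x y) * u x    ≡⟨ ∑-swap xs ys _ ⟩
  ∑[ y ∈ ys ] ∑[ x ∈ xs ] 𝟙 (R? x y) * u x
    ≡⟨ ∑-cong ys (λ y → ∑-cong xs (λ x → 𝟙-*-cong (R? x y) u≡v)) ⟩
  ∑[ y ∈ ys ] ∑[ x ∈ xs ] 𝟙 (R? x y) * v y    ≡⟨ ∑-cong ys (λ y → ∑-*ʳ xs (v y) _) ⟩
  ∑[ y ∈ ys ] (∑[ x ∈ xs ] 𝟙 (R? x y)) * v y  ∎
  where open ≡-Reasoning

uniqueSolution : ∀ {A : Set} {P : A → Set} {xs} → Unique xs → (∀ {x y} → P x → P y → x ≡ y) →
                 AllPairs (λ x y → ¬ (P x × P y)) xs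
uniqueSolution xs! P! = AllPairs.map (λ x≢y (p , q) → x≢y (P! p q)) xs!

∑-allFin-≟ : ∀ {n} (i : Fin n) → ∑[ j ∈ allFin n ] 𝟙 (j Fin.≟ i) ≡ 1
∑-allFin-≟ {n} i = ∑-≡1 (Fin._≟ i) (uniqueSolution (Unique.allFin⁺ n) (λ p q → trans p (sym q)))
  (Any.map sym (∈-allFin i))

-- Permutations as insertion codes

-- If y were missed, punching it out would embed `Fin (suc n)` in `Fin n`.
injective⇒surjective : ∀ {n} {f : Fin n → Fin n} → Injective _≡_ _≡_ f → ∀ y → ∃ λ x → f x ≡ y
injective⇒surjective {suc n} {f} f-inj y with Fin.any? (λ x → f x Fin.≟ y)
... | yes hit  = hit
... | no  miss = contradiction
  (Fin.injective⇒≤ {f = λ x → punchOut (y≢f x)}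
    (λ {x} {x′} → f-inj ∘ Fin.punchOut-injective (y≢f x) (y≢f x′)))
  1+n≰n
  where
  y≢f : ∀ x → y ≢ f x
  y≢f x y≡fx = miss (x , sym y≡fx)

-- A permutation of Fin (suc n) arises from one of Fin n by inserting the
-- element zero into its cycle notation: as a fixed point (insert zero),
-- or right after the element x (insert (suc x)).

data Perm : ℕ → Set where
  []     : Perm 0
  insert : ∀ {n} → Fin (suc n) → Perm n → Perm (suc n)

-- The transposition of zero and i. A code acts by this transposition followed by the shorter
-- permutation on the successors.
swap : ∀ {n} → Fin (suc n) → Fin (suc n) → Fin (suc n)
swap zero    j       = j
swap (suc x) zero    = suc x
swap (suc x) (suc j) = if does (j Fin.≟ x) then zero else suc j

lift : ∀ {n} → (Fin n → Fin n) → Fin (suc n) → Fin (suc n)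
lift f zero    = zero
lift f (suc j) = suc (f j)

infix 8 _⟨_⟩
_⟨_⟩ : ∀ {n} → Perm n → Fin n → Fin n
insert i p ⟨ j ⟩ = lift (p ⟨_⟩) (swap i j)

swap-diagonal : ∀ {n} (i : Fin (suc n)) → swap i i ≡ zero
swap-diagonal zero = refl
swap-diagonal (suc x) with x Fin.≟ x
... | yes _  = refl
... | no x≢x = contradiction refl x≢x

swap-zero : ∀ {n} (i : Fin (suc n)) → swap i zero ≡ i
swap-zero zero    = refl
swap-zero (suc x) = refl

swap-involutive : ∀ {n} (i j : Fin (suc n)) → swap i (swap i j) ≡ j
swap-involutive zero    j       = refl
swap-involutive (suc x) zero    = swap-diagonal (suc x)
swap-involutive (suc x) (suc j) with j Fin.≟ x
... | yes refl = refl
... | no  j≢x with j Fin.≟ x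
...   | yes j≡x = contradiction j≡x j≢x
...   | no  _   = refl

lift-injective : ∀ {n} {f : Fin n → Fin n} → Injective _≡_ _≡_ f → Injective _≡_ _≡_ (lift f)
lift-injective f-inj {zero}  {zero}  _ = refl
lift-injective f-inj {suc i} {suc j} e = cong suc (f-inj (Fin.suc-injective e))

swap-injective : ∀ {n} (i : Fin (suc n)) → Injective _≡_ _≡_ (swap i)
swap-injective i {j} {k} e =
  trans (sym (swap-involutive i j)) (trans (cong (swap i) e) (swap-involutive i k))

⟨⟩-injective : ∀ {n} (p : Perm n) → Injective _≡_ _≡_ (p ⟨_⟩)
⟨⟩-injective (insert i p) = swap-injective i ∘ lift-injective (⟨⟩-injective p)

insert-pivot : ∀ {n} i (p : Perm n) → insert i p ⟨ i ⟩ ≡ zero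
insert-pivot i p = cong (lift (p ⟨_⟩)) (swap-diagonal i)

-- The position of the last insertion is recovered from the action as the preimage of zero.
⟨⟩-extensional : ∀ {n} (p q : Perm n) → (∀ x → p ⟨ x ⟩ ≡ q ⟨ x ⟩) → p ≡ q
⟨⟩-extensional []           []           _ = refl
⟨⟩-extensional (insert i p) (insert j q) e = cong₂ insert i≡j (⟨⟩-extensional p q tails)
  where
  i≡j : i ≡ j
  i≡j = ⟨⟩-injective (insert j q)
    (trans (sym (e i)) (trans (insert-pivot i p) (sym (insert-pivot j q))))
  atSwap : ∀ k (r : Perm _) x → insert k r ⟨ swap k (suc x) ⟩ ≡ suc (r ⟨ x ⟩)
  atSwap k r x = cong (lift (r ⟨_⟩)) (swap-involutive k (suc x))
  tails : ∀ x → p ⟨ x ⟩ ≡ q ⟨ x ⟩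
  tails x = Fin.suc-injective (trans (sym (atSwap i p x))
    (trans (e _) (trans (cong (λ k → insert j q ⟨ swap k (suc x) ⟩) i≡j) (atSwap j q x))))

-- Precomposing f with the transposition of zero and its preimage i gives an injection that fixes
-- zero; what it does on the successors is encoded recursively.
encode : ∀ {n} (f : Fin n → Fin n) → Injective _≡_ _≡_ f → ∃ λ p → ∀ x → p ⟨ x ⟩ ≡ f x
encode {zero}  f f-inj = [] , λ ()
encode {suc n} f f-inj with injective⇒surjective f-inj zero
... | i , fi≡0 with encode (λ j → punchOut (0≢g j)) rest-injective
  where
  g : Fin (suc n) → Fin (suc n)
  g = f ∘ swap i
  g-zero : g zero ≡ zero
  g-zero = trans (cong f (swap-zero i)) fi≡0
  g-injective : Injective _≡_ _≡_ g
  g-injective = swap-injective i ∘ f-inj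
  0≢g : ∀ j → zero ≢ g (suc j)
  0≢g j e with g-injective {zero} {suc j} (trans g-zero e)
  ... | ()
  rest-injective : Injective _≡_ _≡_ (λ j → punchOut (0≢g j))
  rest-injective {j} {k} e =
    Fin.suc-injective (g-injective (Fin.punchOut-injective (0≢g j) (0≢g k) e))
... | p , p≗ = insert i p , λ j → trans (lifted (swap i j)) (cong f (swap-involutive i j))
  where
  lifted : ∀ j → lift (p ⟨_⟩) j ≡ f (swap i j)
  lifted zero    = sym (trans (cong f (swap-zero i)) fi≡0)
  lifted (suc j) = trans (cong suc (p≗ j)) (Fin.punchIn-punchOut {i = zero} _)

perms : ∀ n → List (Perm n)
perms zero    = [ [] ]
perms (suc n) = cartesianProductWith (λ p i → insert i p) (perms n) (allFin (suc n))

∈-perms : ∀ {n} (p : Perm n) → p ∈ perms n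
∈-perms []           = here refl
∈-perms (insert i p) = ∈-cartesianProductWith⁺ (λ p i → insert i p) (∈-perms p) (∈-allFin i)

perms-unique : ∀ n → Unique (perms n)
perms-unique zero    = [] ∷ []
perms-unique (suc n) = Unique.cartesianProductWith⁺ (λ p i → insert i p)
  (λ { refl → refl , refl }) (perms-unique n) (Unique.allFin⁺ (suc n))

∑-perms-suc : ∀ n (f : Perm (suc n) → ℕ) →
  ∑ (perms (suc n)) f ≡ ∑[ p ∈ perms n ] (f (insert zero p) + (∑[ x ∈ allFin n ] f (insert (suc x) p)))
∑-perms-suc n f = trans
  (∑-cartesianProductWith (λ p i → insert i p) (perms n) (allFin (suc n)) f)
  (∑-cong (perms n) (λ p → ∑-allFin-suc n (λ i → f (insert i p))))

∑-const-allFin : ∀ n c → ∑[ _ ∈ allFin n ] c ≡ n * c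
∑-const-allFin n c = trans (∑-const (allFin n) c) (cong (_* c) (length-tabulate {n = n} id))

∑-perms-1 : ∀ n → ∑[ _ ∈ perms n ] 1 ≡ n !
∑-perms-1 zero    = refl
∑-perms-1 (suc n) = begin
  ∑[ _ ∈ perms (suc n) ] 1                          ≡⟨ ∑-perms-suc n (λ _ → 1) ⟩
  ∑[ _ ∈ perms n ] suc (∑[ _ ∈ allFin n ] 1)
    ≡⟨ ∑-cong (perms n) (λ _ → cong suc (trans (∑-const-allFin n 1) (*-comm n 1))) ⟩
  ∑[ _ ∈ perms n ] 1 * suc n                ≡⟨ ∑-*ʳ (perms n) (suc n) _ ⟩
  (∑[ _ ∈ perms n ] 1) * suc n                      ≡⟨ cong (_* suc n) (∑-perms-1 n) ⟩
  n ! * suc n                                       ≡⟨ *-comm (n !) (suc n) ⟩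
  suc n !                                           ∎
  where open ≡-Reasoning

-- Cycles

#cycles : ∀ {n} → Perm n → ℕ
#cycles []                 = 0
#cycles (insert zero p)    = suc (#cycles p)
#cycles (insert (suc _) p) = #cycles p

cycle : ∀ {n} (p : Perm n) → Fin n → Fin (#cycles p)
cycle (insert zero p)    zero    = zero
cycle (insert zero p)    (suc j) = suc (cycle p j)
cycle (insert (suc x) p) zero    = cycle p x
cycle (insert (suc x) p) (suc j) = cycle p j

cycle-⟨⟩ : ∀ {n} (p : Perm n) j → cycle p (p ⟨ j ⟩) ≡ cycle p j
cycle-⟨⟩ (insert zero p)    zero    = refl
cycle-⟨⟩ (insert zero p)    (suc j) = cong suc (cycle-⟨⟩ p j)
cycle-⟨⟩ (insert (suc x) p) zero    = cycle-⟨⟩ p x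
cycle-⟨⟩ (insert (suc x) p) (suc j) with j Fin.≟ x
... | yes refl = refl
... | no  _    = cycle-⟨⟩ p j

Step : ∀ {n} → Perm n → Fin n → Fin n → Set
Step p x y = p ⟨ x ⟩ ≡ y

cycle-surjective : ∀ {n} (p : Perm n) v → ∃ λ j → cycle p j ≡ v
cycle-surjective (insert zero p) zero    = zero , refl
cycle-surjective (insert zero p) (suc v) with cycle-surjective p v
... | j , refl = suc j , refl
cycle-surjective (insert (suc x) p) v with cycle-surjective p v
... | j , refl = suc j , refl

cycle-connected : ∀ {n} (p : Perm n) i j → cycle p i ≡ cycle p j → Star (Step p) i j
cycle-connected (insert zero p) zero    zero    _ = Star.ε
cycle-connected (insert zero p) (suc i) (suc j) e =
  Star.gmap suc (cong suc) (cycle-connected p i j (Fin.suc-injective e))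
cycle-connected (insert (suc x) p) = go
  where
  -- The arrow that leaves x is subdivided: suc x goes to zero and zero to the former image of x.
  -- All other arrows are kept.
  lift-step : ∀ {a b} → Step p a b → Star (Step (insert (suc x) p)) (suc a) (suc b)
  lift-step {a} {b} e with a Fin.≟ x in eq
  ... | yes refl = cong (λ d → lift (p ⟨_⟩) (if does d then zero else suc a)) eq ◅ cong suc e ◅ Star.ε
  ... | no _     = trans (cong (λ d → lift (p ⟨_⟩) (if does d then zero else suc a)) eq) (cong suc e) ◅ Star.ε
  lift-star : ∀ {a b} → Star (Step p) a b → Star (Step (insert (suc x) p)) (suc a) (suc b)
  lift-star = Star.kleisliStar suc lift-step
  go : ∀ i j → cycle (insert (suc x) p) i ≡ cycle (insert (suc x) p) j →
       Star (Step (insert (suc x) p)) i j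
  go zero    zero    _ = Star.ε
  go zero    (suc j) e = refl ◅ lift-star (cycle-connected p _ j (trans (cycle-⟨⟩ p x) e))
  go (suc i) zero    e = lift-star (cycle-connected p i x e) ◅◅ (insert-pivot (suc x) p ◅ Star.ε)
  go (suc i) (suc j) e = lift-star (cycle-connected p i j e)

-- Fixed points

isFixed? : ∀ {n} (p : Perm n) j → Dec (p ⟨ j ⟩ ≡ j)
isFixed? p j = p ⟨ j ⟩ Fin.≟ j

#fixed : ∀ {n} → Perm n → ℕ
#fixed {n} p = ∑[ j ∈ allFin n ] 𝟙 (isFixed? p j)

#fixed-insert-zero : ∀ {n} (p : Perm n) → #fixed (insert zero p) ≡ suc (#fixed p)
#fixed-insert-zero {n} p = trans (∑-allFin-suc n (λ j → 𝟙 (isFixed? (insert zero p) j))) (cong suc (∑-cong (allFin n)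
  (λ j → 𝟙-cong (suc (p ⟨ j ⟩) Fin.≟ suc j) (isFixed? p j) Fin.suc-injective (cong suc))))

-- After the insertion x is sent to zero, so it ceases to be fixed if it was. Zero is not fixed, and
-- the other points keep their status.
#fixed-insert-suc : ∀ {n} x (p : Perm n) →
  #fixed (insert (suc x) p) + 𝟙 (isFixed? p x) ≡ #fixed p
#fixed-insert-suc {n} x p = begin
  #fixed (insert (suc x) p) + c
    ≡⟨ cong (_+ c) (∑-allFin-suc n (λ j → 𝟙 (isFixed? (insert (suc x) p) j))) ⟩
  ∑ (allFin n) a + c
    ≡⟨ cong (∑ (allFin n) a +_) (trans (cong (_* c) (∑-allFin-≟ x)) (*-identityˡ c)) ⟨
  ∑ (allFin n) a + (∑[ j ∈ allFin n ] 𝟙 (j Fin.≟ x)) * c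
    ≡⟨ cong (∑ (allFin n) a +_) (∑-*ʳ (allFin n) c _) ⟨
  ∑ (allFin n) a + (∑[ j ∈ allFin n ] 𝟙 (j Fin.≟ x) * c)
    ≡⟨ ∑-+ (allFin n) a _ ⟨
  ∑[ j ∈ allFin n ] (a j + 𝟙 (j Fin.≟ x) * c)
    ≡⟨ ∑-cong (allFin n) pointwise ⟩
  #fixed p ∎
  where
  open ≡-Reasoning
  c : ℕ
  c = 𝟙 (isFixed? p x)
  a : Fin n → ℕ
  a j = 𝟙 (isFixed? (insert (suc x) p) (suc j))
  pointwise : ∀ j → a j + 𝟙 (j Fin.≟ x) * c ≡ 𝟙 (isFixed? p j)
  pointwise j with j Fin.≟ x
  ... | yes refl = *-identityˡ c
  ... | no _     = trans (+-identityʳ _)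
    (𝟙-cong (suc (p ⟨ j ⟩) Fin.≟ suc j) (isFixed? p j) Fin.suc-injective (cong suc))

#withFixed : ℕ → ℕ → ℕ
#withFixed n k = ∑[ p ∈ perms n ] 𝟙 (#fixed p ≟ k)

module _ {n : ℕ} (p : Perm n) (k : ℕ) where

  -- A place x costs one fixed point exactly when p fixes x. Of the n places, `#fixed p` lower the
  -- number of fixed points by one and n - `#fixed p` keep it. The indicators then allow `#fixed p`
  -- to be replaced by suc k or k.
  ∑-insert-suc :
    (∑[ x ∈ allFin n ] 𝟙 (#fixed (insert (suc x) p) ≟ k)) + k * 𝟙 (#fixed p ≟ k) ≡
    suc k * 𝟙 (#fixed p ≟ suc k) + n * 𝟙 (#fixed p ≟ k)
  ∑-insert-suc = begin
    ∑ (allFin n) a + k * b     ≡⟨ cong (∑ (allFin n) a +_) (weigh k) ⟨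
    ∑ (allFin n) a + #fixed p * b
      ≡⟨ cong (∑ (allFin n) a +_) (∑-*ʳ (allFin n) b f) ⟨
    ∑ (allFin n) a + (∑[ x ∈ allFin n ] f x * b)   ≡⟨ ∑-+ (allFin n) a _ ⟨
    ∑[ x ∈ allFin n ] (a x + f x * b)            ≡⟨ ∑-cong (allFin n) pointwise ⟩
    ∑[ x ∈ allFin n ] (f x * b′ + b)             ≡⟨ ∑-+ (allFin n) _ _ ⟩
    (∑[ x ∈ allFin n ] f x * b′) + (∑[ _ ∈ allFin n ] b)
      ≡⟨ cong₂ _+_ (∑-*ʳ (allFin n) b′ f) (∑-const-allFin n b) ⟩
    #fixed p * b′ + n * b                        ≡⟨ cong (_+ n * b) (weigh (suc k)) ⟩
    suc k * b′ + n * b                           ∎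
    where
    open ≡-Reasoning
    b b′ : ℕ
    b  = 𝟙 (#fixed p ≟ k)
    b′ = 𝟙 (#fixed p ≟ suc k)
    f a : Fin n → ℕ
    f x = 𝟙 (isFixed? p x)
    a x = 𝟙 (#fixed (insert (suc x) p) ≟ k)
    weigh : ∀ k → #fixed p * 𝟙 (#fixed p ≟ k) ≡ k * 𝟙 (#fixed p ≟ k)
    weigh k = trans (*-comm (#fixed p) _)
      (trans (𝟙-*-cong (#fixed p ≟ k) {#fixed p} {k} id) (*-comm _ k))
    pointwise : ∀ x → a x + f x * b ≡ f x * b′ + b
    pointwise x with isFixed? p x | #fixed-insert-suc x p
    ... | no  _ | e = trans (+-identityʳ (a x)) (cong (λ m → 𝟙 (m ≟ k)) (trans (sym (+-identityʳ _)) e))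
    ... | yes _ | e = cong₂ _+_ (trans (𝟙-cong (#fixed (insert (suc x) p) ≟ k) (#fixed p ≟ suc k)
          (λ q → trans (sym e) (trans (+-comm _ 1) (cong suc q)))
          (λ q → +-cancelʳ-≡ 1 _ _ (trans e (trans q (+-comm 1 k)))))
        (sym (+-identityʳ b′))) (+-identityʳ b)

#withFixed₋ : ℕ → ℕ → ℕ
#withFixed₋ n zero    = 0
#withFixed₋ n (suc k) = #withFixed n k

-- Classifying by the place where zero is inserted, with a term moved to
-- the left in order to avoid the subtraction in n ∸ k.

#withFixed-suc : ∀ n k → #withFixed (suc n) k + k * #withFixed n k ≡
  #withFixed₋ n k + (suc k * #withFixed n (suc k) + n * #withFixed n k)
#withFixed-suc n k = begin
  #withFixed (suc n) k + k * #withFixed n k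
    ≡⟨ cong₂ _+_ (∑-perms-suc n _) (sym (∑-*ˡ P k (b k))) ⟩
  (∑[ p ∈ P ] (𝟙 (#fixed (insert zero p) ≟ k) + c p)) + (∑[ p ∈ P ] k * b k p)
    ≡⟨ cong (_+ (∑[ p ∈ P ] k * b k p)) (∑-+ P (λ p → 𝟙 (#fixed (insert zero p) ≟ k)) c) ⟩
  (∑[ p ∈ P ] 𝟙 (#fixed (insert zero p) ≟ k)) + ∑ P c + (∑[ p ∈ P ] k * b k p)
    ≡⟨ +-assoc (∑[ p ∈ P ] 𝟙 (#fixed (insert zero p) ≟ k)) _ _ ⟩
  (∑[ p ∈ P ] 𝟙 (#fixed (insert zero p) ≟ k)) + (∑ P c + (∑[ p ∈ P ] k * b k p))
    ≡⟨ cong₂ _+_ (first k) (trans (sym (∑-+ P c _)) (∑-cong P (λ p → ∑-insert-suc p k))) ⟩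
  #withFixed₋ n k + (∑[ p ∈ P ] (suc k * b (suc k) p + n * b k p))
    ≡⟨ cong (#withFixed₋ n k +_) (∑-+ P _ _) ⟩
  #withFixed₋ n k + ((∑[ p ∈ P ] suc k * b (suc k) p) + (∑[ p ∈ P ] n * b k p))
    ≡⟨ cong (#withFixed₋ n k +_) (cong₂ _+_ (∑-*ˡ P (suc k) (b (suc k))) (∑-*ˡ P n (b k))) ⟩
  #withFixed₋ n k + (suc k * #withFixed n (suc k) + n * #withFixed n k) ∎
  where
  open ≡-Reasoning
  P : List (Perm n)
  P = perms n
  b : ℕ → Perm n → ℕ
  b k p = 𝟙 (#fixed p ≟ k)
  c : Perm n → ℕ
  c p = ∑[ x ∈ allFin n ] 𝟙 (#fixed (insert (suc x) p) ≟ k)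
  first : ∀ k → ∑[ p ∈ P ] 𝟙 (#fixed (insert zero p) ≟ k) ≡ #withFixed₋ n k
  first zero    = trans
    (∑-cong P (λ p → 𝟙-no (#fixed (insert zero p) ≟ 0) (λ e → 1+n≢0 (trans (sym (#fixed-insert-zero p)) e))))
    (trans (∑-const P 0) (*-zeroʳ (length P)))
  first (suc k) = ∑-cong P (λ p → 𝟙-cong (#fixed (insert zero p) ≟ suc k) (#fixed p ≟ k)
    (λ e → suc-injective (trans (sym (#fixed-insert-zero p)) e))
    (λ e → trans (#fixed-insert-zero p) (cong suc e)))

-- Half-edges as numbers

-- The edge e receives the numbers 2e and 2e + 1. The recursion follows the unfolding of
-- `suc n * 2`, so that functions of the edge reduce along with it.
enc : ∀ {n} → HalfEdge n → Fin (n * 2)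
enc (zero  , false) = zero
enc (zero  , true)  = suc zero
enc (suc e , b)     = suc (suc (enc (e , b)))

dec : ∀ n → Fin (n * 2) → HalfEdge n
dec (suc n) zero          = zero , false
dec (suc n) (suc zero)    = zero , true
dec (suc n) (suc (suc i)) = map₁ suc (dec n i)

dec-enc : ∀ {n} (h : HalfEdge n) → dec n (enc h) ≡ h
dec-enc (zero  , false) = refl
dec-enc (zero  , true)  = refl
dec-enc (suc e , b)     = cong (map₁ suc) (dec-enc (e , b))

enc-dec : ∀ n (i : Fin (n * 2)) → enc (dec n i) ≡ i
enc-dec (suc n) zero          = refl
enc-dec (suc n) (suc zero)    = refl
enc-dec (suc n) (suc (suc i)) = cong (λ i → suc (suc i)) (enc-dec n i)

enc-injective : ∀ {n} → Injective _≡_ _≡_ (enc {n})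
enc-injective {n} {h} {h′} e = trans (sym (dec-enc h)) (trans (cong (dec n) e) (dec-enc h′))

dec-injective : ∀ n → Injective _≡_ _≡_ (dec n)
dec-injective n {i} {j} e = trans (sym (enc-dec n i)) (trans (cong enc e) (enc-dec n j))

halfEdges-unique : ∀ n → Unique (halfEdges n)
halfEdges-unique n = Unique.cartesianProduct⁺ (Unique.allFin⁺ n) (((λ ()) ∷ []) ∷ [] ∷ [])

∑-halfEdges : ∀ n (f : HalfEdge n → ℕ) → ∑ (halfEdges n) f ≡ ∑[ i ∈ allFin (n * 2) ] f (dec n i)
∑-halfEdges n f = trans (∑-cartesianProductWith _,_ (allFin n) (false ∷ true ∷ []) f) (pairs n f)
  where
  pairs : ∀ n (f : HalfEdge n → ℕ) →
          ∑[ e ∈ allFin n ] ∑[ b ∈ false ∷ true ∷ [] ] f (e , b) ≡ ∑[ i ∈ allFin (n * 2) ] f (dec n i)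
  pairs zero    f = refl
  pairs (suc n) f = begin
    (∑[ e ∈ allFin (suc n) ] ∑[ b ∈ bs ] f (e , b))
      ≡⟨ ∑-allFin-suc n (λ e → ∑[ b ∈ bs ] f (e , b)) ⟩
    (∑[ b ∈ bs ] f (zero , b)) + (∑[ e ∈ allFin n ] ∑[ b ∈ bs ] f (suc e , b))
      ≡⟨ cong₂ _+_ (cong (f (zero , false) +_) (+-identityʳ _)) (pairs n (f ∘ map₁ suc)) ⟩
    f (zero , false) + f (zero , true) + (∑[ i ∈ allFin (n * 2) ] f (map₁ suc (dec n i)))
      ≡⟨ +-assoc (f (zero , false)) _ _ ⟩
    f (zero , false) + (f (zero , true) + (∑[ i ∈ allFin (n * 2) ] f (map₁ suc (dec n i))))
      ≡⟨ cong (f (zero , false) +_) (∑-allFin-suc (n * 2) (f ∘ dec (suc n) ∘ suc)) ⟨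
    f (zero , false) + (∑[ i ∈ allFin (suc (n * 2)) ] f (dec (suc n) (suc i)))
      ≡⟨ ∑-allFin-suc (suc (n * 2)) (f ∘ dec (suc n)) ⟨
    (∑[ i ∈ allFin (suc n * 2) ] f (dec (suc n) i)) ∎
    where
    open ≡-Reasoning
    bs : List Bool
    bs = false ∷ true ∷ []

infix 21 _⟪_⟫
_⟪_⟫ : ∀ {n} → Perm (n * 2) → HalfEdge n → HalfEdge n
_⟪_⟫ {n} p h = dec n (p ⟨ enc h ⟩)

module _ {n : ℕ} where

  ⟪⟫-injective : (p : Perm (n * 2)) → Injective _≡_ _≡_ (_⟪_⟫ {n} p)
  ⟪⟫-injective p = enc-injective ∘ ⟨⟩-injective p ∘ dec-injective n

  ⟪⟫-extensional : (p q : Perm (n * 2)) → (∀ (h : HalfEdge n) → p ⟪ h ⟫ ≡ q ⟪ h ⟫) → p ≡ q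
  ⟪⟫-extensional p q e = ⟨⟩-extensional p q λ x → dec-injective n
    (subst (λ x → dec n (p ⟨ x ⟩) ≡ dec n (q ⟨ x ⟩)) (enc-dec n x) (e (dec n x)))

  encodeₕ : (f : HalfEdge n → HalfEdge n) → Injective _≡_ _≡_ f →
            ∃ λ (p : Perm (n * 2)) → ∀ h → p ⟪ h ⟫ ≡ f h
  encodeₕ f f-inj with encode (enc ∘ f ∘ dec n) (dec-injective n ∘ f-inj ∘ enc-injective)
  ... | p , p≗ = p , λ h →
    trans (cong (dec n) (p≗ (enc h))) (trans (dec-enc _) (cong f (dec-enc h)))

  injective⇒surjectiveₕ : {f : HalfEdge n → HalfEdge n} → Injective _≡_ _≡_ f →
                          ∀ h → ∃ λ h′ → f h′ ≡ h
  injective⇒surjectiveₕ {f} f-inj h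
    with injective⇒surjective {f = enc ∘ f ∘ dec n} (dec-injective n ∘ f-inj ∘ enc-injective) (enc h)
  ... | i , e = dec n i , enc-injective e

  -- A section of f is injective, hence surjective, hence a two-sided inverse.
  surjective⇒injectiveₕ : {f : HalfEdge n → HalfEdge n} → (∀ h → ∃ λ h′ → f h′ ≡ h) →
                          Injective _≡_ _≡_ f
  surjective⇒injectiveₕ {f} f-surj {a} {b} fa≡fb = trans (sym (s∘f a)) (trans (cong s fa≡fb) (s∘f b))
    where
    s : HalfEdge n → HalfEdge n
    s h = proj₁ (f-surj h)
    f∘s : ∀ h → f (s h) ≡ h
    f∘s h = proj₂ (f-surj h)
    s∘f : ∀ h → s (f h) ≡ h
    s∘f h with injective⇒surjectiveₕ {s} (λ {a} {b} e → trans (sym (f∘s a)) (trans (cong f e) (f∘s b))) h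
    ... | k , refl = cong s (f∘s k)

  permutation : Perm (n * 2) → HalfEdge n ↔ HalfEdge n
  permutation p = mk↔ₛ′ (p ⟪_⟫) (proj₁ ∘ preimage) (proj₂ ∘ preimage)
    (λ h → ⟪⟫-injective p (proj₂ (preimage (p ⟪ h ⟫))))
    where
    preimage : ∀ h → ∃ λ h′ → p ⟪ h′ ⟫ ≡ h
    preimage = injective⇒surjectiveₕ (⟪⟫-injective p)

  -- Maps seen from their half-edges

  Linked : (HalfEdge n → HalfEdge n) → HalfEdge n → HalfEdge n → Set
  Linked s h h′ = s h ≡ h′ ⊎ opposite h ≡ h′

  module _ (m : Map n) where

    -- By cyclicity a walk leads from `next m h` back to h, and its last step starts at a preimage.
    -- If the walk is empty, the preimage is h itself.
    next-surjective : ∀ h → ∃ λ h′ → next m h′ ≡ h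
    next-surjective h = last refl (next-cyclic m (next m h) h (next-vertexOf m h))
      where
      last : ∀ {x y h} → Next m x y → Star (Next m) y h → ∃ λ h′ → next m h′ ≡ h
      last e Star.ε         = _ , e
      last _ (e′ ◅ st) = last e′ st

    next-injective : Injective _≡_ _≡_ (next m)
    next-injective = surjective⇒injectiveₕ next-surjective

    -- A walk through vertices lifts to half-edges: turn around the current vertex up to the
    -- half-edge to be crossed, then pass to its opposite.
    halfEdges-linked : ∀ h h′ → Star (Linked (next m)) h h′
    halfEdges-linked h h′ = go (connected m (vertexOf m h) (vertexOf m h′)) refl refl
      where
      around : ∀ {h h′} → vertexOf m h ≡ vertexOf m h′ → Star (Linked (next m)) h h′
      around e = Star.map inj₁ (next-cyclic m _ _ e)
      go : ∀ {u v h h′} → Star (Adjacent m) u v → vertexOf m h ≡ u → vertexOf m h′ ≡ v →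
           Star (Linked (next m)) h h′
      go Star.ε                refl e′ = around (sym e′)
      go ((k , e , o) ◅ st) refl e′ = around (sym e) ◅◅ inj₂ refl ◅ go st o e′

    next-fixed⇒ : ∀ {h} → next m h ≡ h → ∀ {h′} → vertexOf m h′ ≡ vertexOf m h → h′ ≡ h
    next-fixed⇒ {h} fixed {h′} e = stays refl (next-cyclic m h h′ (sym e))
      where
      stays : ∀ {x y} → x ≡ h → Star (Next m) x y → y ≡ h
      stays x≡h Star.ε           = x≡h
      stays x≡h (refl ◅ st) = stays (trans (cong (next m) x≡h) fixed) st

    degree-∑ : ∀ v → degree m v ≡ ∑[ h ∈ halfEdges n ] 𝟙 (vertexOf m h Fin.≟ v)
    degree-∑ v = length-filter-∑ (λ h → vertexOf m h Fin.≟ v) (halfEdges n)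

    next-fixed⇒degree1 : ∀ h → next m h ≡ h → degree m (vertexOf m h) ≡ 1
    next-fixed⇒degree1 h fixed = trans (degree-∑ (vertexOf m h))
      (∑-≡1 (λ h′ → vertexOf m h′ Fin.≟ vertexOf m h)
        (uniqueSolution (halfEdges-unique n)
          (λ p q → trans (next-fixed⇒ fixed p) (sym (next-fixed⇒ fixed q))))
        (Any.map (λ e → cong (vertexOf m) (sym e)) (∈-halfEdges h)))

    -- Both h and `next m h` occur in the list of half-edges at this vertex, which has a single
    -- entry.
    degree1⇒next-fixed : ∀ h → degree m (vertexOf m h) ≡ 1 → next m h ≡ h
    degree1⇒next-fixed h e = both
      (filter P? (halfEdges n)) e
      (∈-filter⁺ P? (∈-halfEdges (next m h)) (next-vertexOf m h))
      (∈-filter⁺ P? (∈-halfEdges h) refl)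
      where
      P? = λ h′ → vertexOf m h′ Fin.≟ vertexOf m h
      both : ∀ xs → length xs ≡ 1 → ∀ {x y : HalfEdge n} → x ∈ xs → y ∈ xs → x ≡ y
      both (_ ∷ []) _ (here refl) (here refl) = refl

    -- Incidences are counted with the indicator of degree 1 as weight: a leaf has one incidence,
    -- and every half-edge lies at one vertex.
    #leaves-fixed : #leaves m ≡ ∑[ h ∈ halfEdges n ] 𝟙 (next m h ≟ₕ h)
    #leaves-fixed = begin
      #leaves m
        ≡⟨ length-filter-∑ (λ v → degree m v ≟ 1) V ⟩
      ∑[ v ∈ V ] 𝟙 (degree m v ≟ 1)
        ≡⟨ ∑-cong V atVertex ⟩
      ∑[ v ∈ V ] (∑[ h ∈ H ] 𝟙 (vertexOf m h Fin.≟ v)) * 𝟙 (degree m v ≟ 1)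
        ≡⟨ doubleCounting (λ v h → vertexOf m h Fin.≟ v) (λ { refl → refl }) V H ⟩
      ∑[ h ∈ H ] (∑[ v ∈ V ] 𝟙 (vertexOf m h Fin.≟ v)) * 𝟙 (degree m (vertexOf m h) ≟ 1)
        ≡⟨ ∑-cong H atHalfEdge ⟩
      ∑[ h ∈ H ] 𝟙 (next m h ≟ₕ h) ∎
      where
      open ≡-Reasoning
      V = allFin (#vertices m)
      H = halfEdges n
      atVertex : ∀ v → 𝟙 (degree m v ≟ 1) ≡
                 (∑[ h ∈ H ] 𝟙 (vertexOf m h Fin.≟ v)) * 𝟙 (degree m v ≟ 1)
      atVertex v = sym (begin
        (∑[ h ∈ H ] 𝟙 (vertexOf m h Fin.≟ v)) * 𝟙 (degree m v ≟ 1)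
          ≡⟨ cong (_* 𝟙 (degree m v ≟ 1)) (degree-∑ v) ⟨
        degree m v * 𝟙 (degree m v ≟ 1)
          ≡⟨ *-comm (degree m v) _ ⟩
        𝟙 (degree m v ≟ 1) * degree m v
          ≡⟨ 𝟙-*-cong (degree m v ≟ 1) {degree m v} {1} id ⟩
        𝟙 (degree m v ≟ 1) * 1
          ≡⟨ *-identityʳ _ ⟩
        𝟙 (degree m v ≟ 1) ∎)
      atHalfEdge : ∀ h → (∑[ v ∈ V ] 𝟙 (vertexOf m h Fin.≟ v)) * 𝟙 (degree m (vertexOf m h) ≟ 1) ≡
                   𝟙 (next m h ≟ₕ h)
      atHalfEdge h = trans
        (cong (_* 𝟙 (degree m (vertexOf m h) ≟ 1))
          (∑-≡1 (vertexOf m h Fin.≟_)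
            (uniqueSolution (Unique.allFin⁺ _) (λ p q → trans (sym p) q))
            (∈-allFin (vertexOf m h))))
        (trans (*-identityˡ _)
          (𝟙-cong (degree m (vertexOf m h) ≟ 1) (next m h ≟ₕ h)
            (degree1⇒next-fixed h) (next-fixed⇒degree1 h)))

-- Rooted maps and transitive permutations

cycle-connectedₕ : ∀ {n} (p : Perm (n * 2)) (h h′ : HalfEdge n) →
                   cycle p (enc h) ≡ cycle p (enc h′) → Star (λ x y → p ⟪ x ⟫ ≡ y) h h′
cycle-connectedₕ {n} p h h′ e = subst₂ (Star (λ x y → p ⟪ x ⟫ ≡ y)) (dec-enc h) (dec-enc h′)
  (Star.gmap (dec n) (λ {x} s → trans (cong (dec n ∘ (p ⟨_⟩)) (enc-dec n x)) (cong (dec n) s))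
    (cycle-connected p (enc h) (enc h′) e))

Connected : ∀ n → Perm (n * 2) → Set
Connected n p = ∀ (h h′ : HalfEdge n) → Star (Linked (p ⟪_⟫)) h h′

linked? : ∀ n (p : Perm (n * 2)) (h h′ : HalfEdge n) → Dec (Star (Linked (p ⟪_⟫)) h h′)
linked? n p = Reachability.star? _≟ₕ_
  (λ h h′ → (p ⟪ h ⟫ ≟ₕ h′) ⊎-dec (opposite h ≟ₕ h′)) ∈-halfEdges

abstract
  connected? : ∀ n (p : Perm (n * 2)) → Dec (Connected n p)
  connected? n p = allHalfEdges? λ h → allHalfEdges? λ h′ → linked? n p h h′

-- Here n is the number of edges minus one.

module _ {n : ℕ} where

  private
    N : ℕ
    N = suc n

  -- Once there is an edge, connectedness puts a half-edge at every vertex. Corners of the kind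
  -- `alone` are thereby excluded, and a root is just a half-edge.
  pick : (m : Map N) → ∀ v → ∃ λ h → vertexOf m h ≡ v
  pick m v = source (connected m v (vertexOf m (zero , false)))
    where
    source : ∀ {v} → Star (Adjacent m) v (vertexOf m (zero , false)) → ∃ λ h → vertexOf m h ≡ v
    source Star.ε                 = (zero , false) , refl
    source ((h , e , _) ◅ _) = h , e

  rootHalfEdge : {m : Map N} → Corner m → HalfEdge N
  rootHalfEdge         (after h)       = h
  rootHalfEdge {m = m} (alone v empty) = contradiction (proj₂ (pick m v)) (empty _)

  module _ {m m′ : Map N} {f : HalfEdge N → HalfEdge N} {g : Vertex m → Vertex m′} where

    cornerImage⇒ : (c : Corner m) (c′ : Corner m′) → CornerImage f g c c′ →
                   f (rootHalfEdge c) ≡ rootHalfEdge c′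
    cornerImage⇒ (after h)       (after h′)       e = e
    cornerImage⇒ (alone v empty) _                _ = contradiction (proj₂ (pick m v)) (empty _)

    ⇒cornerImage : (c : Corner m) (c′ : Corner m′) → f (rootHalfEdge c) ≡ rootHalfEdge c′ →
                   CornerImage f g c c′
    ⇒cornerImage (after h)       (after h′)       e = e
    ⇒cornerImage (alone v empty) _                _ = contradiction (proj₂ (pick m v)) (empty _)
    ⇒cornerImage (after h)       (alone v empty)  _ = contradiction (proj₂ (pick m′ v)) (empty _)

  -- The half-edges alone determine a map: the vertices are the cycles of next.

  module _ {m m′ : Map N} {f : HalfEdge N → HalfEdge N}
           (f-next : ∀ h → f (next m h) ≡ next m′ (f h)) where

    vertexImage : Vertex m → Vertex m′
    vertexImage v = vertexOf m′ (f (proj₁ (pick m v)))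

    -- f carries turns around a vertex to turns around a vertex, so the image does not depend on the
    -- half-edge that was picked.
    vertexImage-vertexOf : ∀ h → vertexOf m′ (f h) ≡ vertexImage (vertexOf m h)
    vertexImage-vertexOf h = along (next-cyclic m _ _ (sym (proj₂ (pick m (vertexOf m h)))))
      where
      along : ∀ {h h′} → Star (Next m) h h′ → vertexOf m′ (f h) ≡ vertexOf m′ (f h′)
      along Star.ε           = refl
      along (refl ◅ st) = trans (sym (next-vertexOf m′ _))
        (trans (cong (vertexOf m′) (sym (f-next _))) (along st))

  halfEdgeIso : {m m′ : Map N} (f : HalfEdge N ↔ HalfEdge N) →
                (∀ h → Inverse.to f (next m h) ≡ next m′ (Inverse.to f h)) →
                (∀ h → Inverse.to f (opposite h) ≡ opposite (Inverse.to f h)) → Iso m m′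
  halfEdgeIso {m} {m′} f f-next f-opposite = record
    { vertices     = mk↔ₛ′ (vertexImage {m} {m′} f-next) (vertexImage {m′} {m} from-next)
        (λ v → trans (sym (vertexImage-vertexOf {m} {m′} f-next _))
          (trans (cong (vertexOf m′) (strictlyInverseˡ _)) (proj₂ (pick m′ v))))
        (λ v → trans (sym (vertexImage-vertexOf {m′} {m} from-next _))
          (trans (cong (vertexOf m) (strictlyInverseʳ _)) (proj₂ (pick m v))))
    ; halfedges    = f
    ; vertexOf-iso = vertexImage-vertexOf {m} {m′} f-next
    ; opposite-iso = f-opposite
    ; next-iso     = f-next
    }
    where
    open Inverse f using (to; from; strictlyInverseˡ; strictlyInverseʳ)
    from-next : ∀ h → from (next m′ h) ≡ next m (from h)
    from-next h = trans (cong (from ∘ next m′) (sym (strictlyInverseˡ h)))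
      (trans (cong from (sym (f-next (from h)))) (strictlyInverseʳ _))

  mapOfPerm : (p : Perm (N * 2)) → Connected N p → Map N
  mapOfPerm p p-connected = record
    { #vertices     = #cycles p
    ; vertexOf      = vertex
    ; next          = p ⟪_⟫
    ; next-vertexOf = vertex-next
    ; next-cyclic   = cycle-connectedₕ p
    ; connected     = vertices-connected
    }
    where
    vertex : HalfEdge N → Fin (#cycles p)
    vertex h = cycle p (enc h)
    vertex-next : ∀ h → vertex (p ⟪ h ⟫) ≡ vertex h
    vertex-next h = trans (cong (cycle p) (enc-dec N _)) (cycle-⟨⟩ p (enc h))
    vertices-connected : ∀ u v → Star (λ u v → ∃ λ h → vertex h ≡ u × vertex (opposite h) ≡ v) u v
    vertices-connected u v with cycle-surjective p u | cycle-surjective p v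
    ... | i , refl | j , refl = subst₂ (Star _) (cong (cycle p) (enc-dec N i)) (cong (cycle p) (enc-dec N j))
      (along (p-connected (dec N i) (dec N j)))
      where
      along : ∀ {h h′} → Star (Linked (p ⟪_⟫)) h h′ →
              Star (λ u v → ∃ λ h → vertex h ≡ u × vertex (opposite h) ≡ v) (vertex h) (vertex h′)
      along Star.ε                    = Star.ε
      along {h} (inj₁ refl ◅ st) = subst (λ u → Star _ u _) (vertex-next h) (along st)
      along {h} (inj₂ refl ◅ st) = (h , refl , refl) ◅ along st

  Commutes : Perm (N * 2) → Set
  Commutes g = ∀ (h : HalfEdge N) → g ⟪ opposite h ⟫ ≡ opposite (g ⟪ h ⟫)

  abstract
    commutes? : ∀ g → Dec (Commutes g)
    commutes? g = allHalfEdges? λ h → g ⟪ opposite h ⟫ ≟ₕ opposite (g ⟪ h ⟫)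

  -- g relabels M to the map with the vertex permutation p and the root r.

  record Relabels (x : Perm (N * 2) × RootedMap N) (y : Perm (N * 2) × HalfEdge N) : Set where
    constructor relabels
    private
      g = proj₁ x
      M = proj₂ x
      p = proj₁ y
    field
      commutes : Commutes g
      onNext   : ∀ h → p ⟪ g ⟪ h ⟫ ⟫ ≡ g ⟪ next (mapOf M) h ⟫
      onRoot   : g ⟪ rootHalfEdge (root M) ⟫ ≡ proj₂ y

  abstract
    relabels? : ∀ x y → Dec (Relabels x y)
    relabels? (g , M) (p , r) = map′ (λ (a , b , c) → relabels a b c) (λ (relabels a b c) → a , b , c)
      (commutes? g ×-dec allHalfEdges? (λ h → p ⟪ g ⟪ h ⟫ ⟫ ≟ₕ g ⟪ next (mapOf M) h ⟫) ×-dec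
       (g ⟪ rootHalfEdge (root M) ⟫ ≟ₕ r))

  ⟪⟫-surjective : (g : Perm (N * 2)) → ∀ h → ∃ λ (h′ : HalfEdge N) → g ⟪ h′ ⟫ ≡ h
  ⟪⟫-surjective g = injective⇒surjectiveₕ (⟪⟫-injective g)

  relabels-connected : ∀ {g M p r} → Relabels (g , M) (p , r) → Connected N p
  relabels-connected {g} {M} {p} (relabels g-comm g-next _) h h′ with ⟪⟫-surjective g h | ⟪⟫-surjective g h′
  ... | x , refl | x′ , refl = Star.gmap (g ⟪_⟫) step (halfEdges-linked (mapOf M) x x′)
    where
    step : ∀ {x y} → Linked (next (mapOf M)) x y → Linked (p ⟪_⟫) (g ⟪ x ⟫) (g ⟪ y ⟫)
    step (inj₁ refl) = inj₁ (g-next _)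
    step (inj₂ refl) = inj₂ (sym (g-comm _))

  -- g conjugates `next` to p, so it matches the fixed half-edges of the two. The graph of g is
  -- double counted to transport the sum.
  relabels-leaves : ∀ {g M p r} → Relabels (g , M) (p , r) → #leaves (mapOf M) ≡ #fixed p
  relabels-leaves {g} {M} {p} (relabels _ g-next _) = begin
    #leaves m                                  ≡⟨ #leaves-fixed m ⟩
    ∑[ h ∈ H ] 𝟙 (next m h ≟ₕ h)
      ≡⟨ ∑-cong H (λ h → sym (trans (cong (_* 𝟙 (next m h ≟ₕ h)) (image h)) (*-identityˡ _))) ⟩
    ∑[ h ∈ H ] (∑[ k ∈ H ] 𝟙 (g ⟪ h ⟫ ≟ₕ k)) * 𝟙 (next m h ≟ₕ h)
      ≡⟨ doubleCounting (λ h k → g ⟪ h ⟫ ≟ₕ k)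
          (λ { {h} refl → 𝟙-cong (next m h ≟ₕ h) (p ⟪ g ⟪ h ⟫ ⟫ ≟ₕ g ⟪ h ⟫)
            (λ e → trans (g-next h) (cong (g ⟪_⟫) e))
            (λ e → ⟪⟫-injective g (trans (sym (g-next h)) e)) }) H H ⟩
    ∑[ k ∈ H ] (∑[ h ∈ H ] 𝟙 (g ⟪ h ⟫ ≟ₕ k)) * 𝟙 (p ⟪ k ⟫ ≟ₕ k)
      ≡⟨ ∑-cong H (λ k → trans (cong (_* 𝟙 (p ⟪ k ⟫ ≟ₕ k)) (preimage k)) (*-identityˡ _)) ⟩
    ∑[ k ∈ H ] 𝟙 (p ⟪ k ⟫ ≟ₕ k)                ≡⟨ ∑-halfEdges N (λ k → 𝟙 (p ⟪ k ⟫ ≟ₕ k)) ⟩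
    ∑[ i ∈ allFin (N * 2) ] 𝟙 (p ⟪ dec N i ⟫ ≟ₕ dec N i)
      ≡⟨ ∑-cong (allFin (N * 2)) (λ i → 𝟙-cong (p ⟪ dec N i ⟫ ≟ₕ dec N i) (isFixed? p i)
          (λ e → trans (cong (p ⟨_⟩) (sym (enc-dec N i))) (dec-injective N e))
          (λ e → cong (dec N) (trans (cong (p ⟨_⟩) (enc-dec N i)) e))) ⟩
    #fixed p ∎
    where
    open ≡-Reasoning
    m = mapOf M
    H = halfEdges N
    image : ∀ h → ∑[ k ∈ H ] 𝟙 (g ⟪ h ⟫ ≟ₕ k) ≡ 1
    image h = ∑-≡1 (g ⟪ h ⟫ ≟ₕ_) (uniqueSolution (halfEdges-unique N) (λ e e′ → trans (sym e) e′))
      (∈-halfEdges _)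
    preimage : ∀ k → ∑[ h ∈ H ] 𝟙 (g ⟪ h ⟫ ≟ₕ k) ≡ 1
    preimage k = ∑-≡1 (λ h → g ⟪ h ⟫ ≟ₕ k)
      (uniqueSolution (halfEdges-unique N) (λ e e′ → ⟪⟫-injective g (trans e (sym e′))))
      (Any.map (λ { refl → proj₂ (⟪⟫-surjective g k) }) (∈-halfEdges (proj₁ (⟪⟫-surjective g k))))

  -- By connectedness, a relabelling is determined by the image of the root.

  relabels-rigid : ∀ {g g′ M y} → Relabels (g , M) y → Relabels (g′ , M) y → g ≡ g′
  relabels-rigid {g} {g′} {M} {p , _} (relabels comm next-g e) (relabels comm′ next-g′ e′) =
    ⟪⟫-extensional g g′ λ h → along (halfEdges-linked m _ h) (trans e (sym e′))
    where
    m = mapOf M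
    along : ∀ {h h′} → Star (Linked (next m)) h h′ → g ⟪ h ⟫ ≡ g′ ⟪ h ⟫ → g ⟪ h′ ⟫ ≡ g′ ⟪ h′ ⟫
    along Star.ε                e = e
    along (inj₁ refl ◅ st) e = along st (trans (sym (next-g _)) (trans (cong (p ⟪_⟫) e) (next-g′ _)))
    along (inj₂ refl ◅ st) e = along st (trans (comm _) (trans (cong opposite e) (sym (comm′ _))))

  -- The composite of g with the inverse of g′ respects `next`, `opposite` and the root. Hence at
  -- most one entry of a list of pairwise non-isomorphic maps relabels to y.
  relabels-iso : ∀ {g g′ M M′ y} → Relabels (g , M) y → Relabels (g′ , M′) y → M ≅ M′
  relabels-iso {g} {g′} {M} {M′} {p , _} (relabels comm next-g e) (relabels comm′ next-g′ e′) = record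
    { iso      = halfEdgeIso f f-next f-opposite
    ; root-iso = ⇒cornerImage (root M) (root M′)
        (⟪⟫-injective g′ (trans (g′∘f _) (trans e (sym e′))))
    }
    where
    f : HalfEdge N ↔ HalfEdge N
    f = ↔-trans (permutation {N} g) (↔-sym (permutation {N} g′))
    to : HalfEdge N → HalfEdge N
    to = Inverse.to f
    g′∘f : ∀ h → g′ ⟪ to h ⟫ ≡ g ⟪ h ⟫
    g′∘f h = Inverse.strictlyInverseˡ (permutation {N} g′) (g ⟪ h ⟫)
    f-next : ∀ h → to (next (mapOf M) h) ≡ next (mapOf M′) (to h)
    f-next h = ⟪⟫-injective g′ (trans (g′∘f _) (trans (sym (next-g h))
      (trans (cong (p ⟪_⟫) (sym (g′∘f h))) (next-g′ _))))
    f-opposite : ∀ h → to (opposite h) ≡ opposite (to h)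
    f-opposite h = ⟪⟫-injective g′ (trans (g′∘f _) (trans (comm h)
      (trans (cong opposite (sym (g′∘f h))) (sym (comm′ _)))))

  relabelled : ∀ g M → Commutes g → ∃ λ y → Relabels (g , M) y
  relabelled g M g-comm = (proj₁ p , _) , relabels g-comm (λ h → trans (proj₂ p (g ⟪ h ⟫))
      (cong (λ h → g ⟪ next (mapOf M) h ⟫) (strictlyInverseʳ h))) refl
    where
    open Inverse (permutation {N} g) using (from; strictlyInverseˡ; strictlyInverseʳ)
    p : ∃ λ (p : Perm (N * 2)) → ∀ h → p ⟪ h ⟫ ≡ g ⟪ next (mapOf M) (from h) ⟫
    p = encodeₕ (λ h → g ⟪ next (mapOf M) (from h) ⟫) λ {x} {y} e →
      trans (sym (strictlyInverseˡ x)) (trans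
        (cong (g ⟪_⟫) (next-injective (mapOf M) (⟪⟫-injective g e))) (strictlyInverseˡ y))

  relabelled-unique : ∀ {x y y′} → Relabels x y → Relabels x y′ → y ≡ y′
  relabelled-unique {g , M} {p , _} {p′ , _} (relabels _ e refl) (relabels _ e′ refl) =
    cong (_, _) (⟪⟫-extensional p p′ λ h → subst (λ h → p ⟪ h ⟫ ≡ p′ ⟪ h ⟫) (proj₂ (⟪⟫-surjective g h))
      (trans (e _) (sym (e′ _))))

  ≅⇒relabels : ∀ {p r M} (c : Connected N p) → (mapOfPerm p c rootedAt after r) ≅ M →
               ∃ λ g → Relabels (g , M) (p , r)
  ≅⇒relabels {p} {r} {M} c i = proj₁ g , relabels
    (λ h → trans (g≗ _) (trans (opposite-iso i⁻¹ h) (cong opposite (sym (g≗ h)))))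
    (λ h → trans (cong (p ⟪_⟫) (g≗ h)) (trans (sym (next-iso i⁻¹ h)) (sym (g≗ _))))
    (trans (g≗ _) (cornerImage⇒ (root M) (after r) (_≅_.root-iso (≅-sym i))))
    where
    i⁻¹ : Iso (mapOf M) (mapOfPerm p c)
    i⁻¹ = _≅_.iso (≅-sym i)
    open Inverse (halfedges i⁻¹) using (strictlyInverseʳ; from)
    g : ∃ λ (g : Perm (N * 2)) → ∀ h → g ⟪ h ⟫ ≡ onHalfEdge i⁻¹ h
    g = encodeₕ (onHalfEdge i⁻¹) λ {x} {y} e →
      trans (sym (strictlyInverseʳ x)) (trans (cong from e) (strictlyInverseʳ y))
    g≗ = proj₂ g

  private
    Ps : List (Perm (N * 2))
    Ps = perms (N * 2)
    Ms : List (RootedMap N)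
    Ms = rootedMaps N
    labelled : List (Perm (N * 2) × HalfEdge N)
    labelled = cartesianProduct Ps (halfEdges N)

  -- g determines its target: p has to be the conjugate of `next` by g, and r the image of the root.
  -- The count is therefore the same for all M.
  #relabelled : ∀ g M → ∑[ y ∈ labelled ] 𝟙 (relabels? (g , M) y) ≡ 𝟙 (commutes? g)
  #relabelled g M = trans
    (∑-≤1 (relabels? (g , M)) (uniqueSolution labelled-unique relabelled-unique))
    (𝟙-cong (any? (relabels? (g , M)) labelled) (commutes? g)
      (λ p → Relabels.commutes (proj₂ (Any.satisfied p)))
      (λ c → let y , rel = relabelled g M c in Any.map (λ { refl → rel })
        (∈-cartesianProduct⁺ (∈-perms (proj₁ y)) (∈-halfEdges (proj₂ y)))))
    where
    labelled-unique : Unique labelled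
    labelled-unique = Unique.cartesianProduct⁺ (perms-unique (N * 2)) (halfEdges-unique N)

  -- The pair `(p , r)` determines M up to isomorphism, hence its entry in `rootedMaps`, and then g
  -- by rigidity. If p is transitive, its cycles form a map, and the entry isomorphic to it provides
  -- g; conversely, a relabelled map makes p transitive.
  #labellings : ∀ p r → ∑[ x ∈ cartesianProduct Ps Ms ] 𝟙 (relabels? x (p , r)) ≡ 𝟙 (connected? N p)
  #labellings p r = begin
    ∑[ x ∈ cartesianProduct Ps Ms ] 𝟙 (relabels? x (p , r))
      ≡⟨ ∑-cartesianProductWith _,_ Ps Ms _ ⟩
    ∑[ g ∈ Ps ] ∑[ M ∈ Ms ] 𝟙 (relabels? (g , M) (p , r))
      ≡⟨ ∑-swap Ps Ms _ ⟩
    ∑[ M ∈ Ms ] ∑[ g ∈ Ps ] 𝟙 (relabels? (g , M) (p , r))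
      ≡⟨ ∑-cong Ms (λ M → ∑-≤1 (λ g → relabels? (g , M) (p , r))
          (uniqueSolution (perms-unique (N * 2)) (λ {g} {g′} → relabels-rigid {g} {g′} {M}))) ⟩
    ∑[ M ∈ Ms ] 𝟙 (some? M)
      ≡⟨ ∑-≤1 some? (AllPairs.map (λ M≇M′ (a , b) →
          M≇M′ (relabels-iso (proj₂ (Any.satisfied a)) (proj₂ (Any.satisfied b))))
          (rootedMaps-unique N)) ⟩
    𝟙 (any? some? Ms)
      ≡⟨ 𝟙-cong (any? some? Ms) (connected? N p)
          (λ a → relabels-connected (proj₂ (Any.satisfied (proj₂ (Any.satisfied a)))))
          (λ c → Any.map (λ i → let g , rel = ≅⇒relabels c i in
              Any.map (λ { refl → rel }) (∈-perms g))
            (rootedMaps-complete N (mapOfPerm p c rootedAt after r))) ⟩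
    𝟙 (connected? N p) ∎
    where
    open ≡-Reasoning
    some? : ∀ M → Dec (Any (λ g → Relabels (g , M) (p , r)) Ps)
    some? M = any? (λ g → relabels? (g , M) (p , r)) Ps

  -- The order of the hyperoctahedral group, the centraliser of `opposite`. As a factor common to
  -- all counts of maps it cancels from the leaf law.
  #symmetries : ℕ
  #symmetries = ∑[ g ∈ Ps ] 𝟙 (commutes? g)

  -- Both sides count the pairs of a rooted map and a labelling of it.

  ∑-rootedMaps : (u : ℕ → ℕ) →
    #symmetries * (∑[ M ∈ rootedMaps N ] u (#leaves (mapOf M))) ≡
    N * 2 * (∑[ p ∈ perms (N * 2) ] 𝟙 (connected? N p) * u (#fixed p))
  ∑-rootedMaps u = begin
    #symmetries * (∑[ M ∈ Ms ] u (#leaves (mapOf M)))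
      ≡⟨ ∑-*ʳ Ps (∑[ M ∈ Ms ] u (#leaves (mapOf M))) _ ⟨
    ∑[ g ∈ Ps ] 𝟙 (commutes? g) * (∑[ M ∈ Ms ] u (#leaves (mapOf M)))
      ≡⟨ ∑-cong Ps (λ g → ∑-*ˡ Ms (𝟙 (commutes? g)) _) ⟨
    ∑[ g ∈ Ps ] ∑[ M ∈ Ms ] 𝟙 (commutes? g) * u (#leaves (mapOf M))
      ≡⟨ ∑-cartesianProductWith _,_ Ps Ms (λ (g , M) → 𝟙 (commutes? g) * u (#leaves (mapOf M))) ⟨
    ∑[ x ∈ cartesianProduct Ps Ms ] 𝟙 (commutes? (proj₁ x)) * u (#leaves (mapOf (proj₂ x)))
      ≡⟨ ∑-cong (cartesianProduct Ps Ms)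
          (λ (g , M) → cong (_* u (#leaves (mapOf M))) (sym (#relabelled g M))) ⟩
    ∑[ x ∈ cartesianProduct Ps Ms ]
      (∑[ y ∈ labelled ] 𝟙 (relabels? x y)) * u (#leaves (mapOf (proj₂ x)))
      ≡⟨ doubleCounting relabels? (λ rel → cong u (relabels-leaves rel)) (cartesianProduct Ps Ms) labelled ⟩
    ∑[ y ∈ labelled ] (∑[ x ∈ cartesianProduct Ps Ms ] 𝟙 (relabels? x y)) * u (#fixed (proj₁ y))
      ≡⟨ ∑-cong labelled (λ (p , r) → cong (_* u (#fixed p)) (#labellings p r)) ⟩
    ∑[ y ∈ labelled ] 𝟙 (connected? N (proj₁ y)) * u (#fixed (proj₁ y))
      ≡⟨ ∑-cartesianProductWith _,_ Ps (halfEdges N) _ ⟩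
    ∑[ p ∈ Ps ] ∑[ _ ∈ halfEdges N ] 𝟙 (connected? N p) * u (#fixed p)
      ≡⟨ ∑-cong Ps (λ p → trans (∑-halfEdges N (λ _ → 𝟙 (connected? N p) * u (#fixed p)))
          (∑-const-allFin (N * 2) (𝟙 (connected? N p) * u (#fixed p)))) ⟩
    ∑[ p ∈ Ps ] N * 2 * (𝟙 (connected? N p) * u (#fixed p))
      ≡⟨ ∑-*ˡ Ps (N * 2) _ ⟩
    N * 2 * (∑[ p ∈ Ps ] 𝟙 (connected? N p) * u (#fixed p)) ∎
    where open ≡-Reasoning

-- Disconnected permutations

Invariant : ∀ {n} → (Fin n → Bool) → Perm n → Set
Invariant f p = ∀ i → f (p ⟨ i ⟩) ≡ f i

invariant? : ∀ {n} (f : Fin n → Bool) p → Dec (Invariant f p)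
invariant? f p = Fin.all? λ i → f (p ⟨ i ⟩) Bool.≟ f i

#colour : ∀ {n} → (Fin n → Bool) → Bool → ℕ
#colour {n} f c = ∑[ i ∈ allFin n ] 𝟙 (f i Bool.≟ c)

-- The point i is sent to zero, so the two share a colour. The transposition then preserves colours
-- and can be undone without affecting invariance.
insert-invariant : ∀ {n} {f : Fin (suc n) → Bool} {i p} → Invariant f (insert i p) →
                   Invariant (f ∘ suc) p × f i ≡ f zero
insert-invariant {n} {f} {i} {p} inv = rest , fi≡f0
  where
  fi≡f0 : f i ≡ f zero
  fi≡f0 = trans (sym (inv i)) (cong f (insert-pivot i p))
  f-swap : ∀ i j → f i ≡ f zero → f (swap i j) ≡ f j
  f-swap zero    j       e = refl
  f-swap (suc x) zero    e = e
  f-swap (suc x) (suc j) e with j Fin.≟ x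
  ... | yes refl = sym e
  ... | no _     = refl
  rest : Invariant (f ∘ suc) p
  rest j = trans (cong (f ∘ lift (p ⟨_⟩)) (sym (swap-involutive i (suc j))))
    (trans (inv (swap i (suc j))) (f-swap i (suc j) fi≡f0))

-- The insertion place must have the colour of zero. The number of such places is the new size of
-- that colour class, which is also the factor by which its factorial grows.
#invariant : ∀ {n} (f : Fin n → Bool) →
  ∑[ p ∈ perms n ] 𝟙 (invariant? f p) ≤ (#colour f true) ! * (#colour f false) !
#invariant {zero}  f = ≤-refl
#invariant {suc n} f = begin
  ∑[ p ∈ perms (suc n) ] 𝟙 (invariant? f p)
    ≡⟨ ∑-cartesianProductWith (λ p i → insert i p) (perms n) (allFin (suc n)) _ ⟩
  ∑[ p ∈ perms n ] ∑[ i ∈ allFin (suc n) ] 𝟙 (invariant? f (insert i p))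
    ≤⟨ ∑-mono (perms n) (λ p → ∑-mono (allFin (suc n)) (λ i → split i p)) ⟩
  ∑[ p ∈ perms n ] ∑[ i ∈ allFin (suc n) ] 𝟙 (invariant? f′ p) * 𝟙 (f i Bool.≟ f zero)
    ≡⟨ ∑-cong (perms n) (λ p → ∑-*ˡ (allFin (suc n)) (𝟙 (invariant? f′ p)) _) ⟩
  ∑[ p ∈ perms n ] 𝟙 (invariant? f′ p) * #colour f (f zero)
    ≡⟨ ∑-*ʳ (perms n) (#colour f (f zero)) _ ⟩
  (∑[ p ∈ perms n ] 𝟙 (invariant? f′ p)) * #colour f (f zero)
    ≤⟨ *-monoˡ-≤ (#colour f (f zero)) (#invariant f′) ⟩
  (#colour f′ true) ! * (#colour f′ false) ! * #colour f (f zero)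
    ≡⟨ grow (f zero) (#colour f) (colour-suc true) (colour-suc false) ⟩
  (#colour f true) ! * (#colour f false) ! ∎
  where
  open ≤-Reasoning
  f′ = f ∘ suc
  split : ∀ i p → 𝟙 (invariant? f (insert i p)) ≤ 𝟙 (invariant? f′ p) * 𝟙 (f i Bool.≟ f zero)
  split i p = 𝟙-≤ (invariant? f (insert i p)) λ inv → ≤-reflexive (sym (cong₂ _*_
    (𝟙-yes (invariant? f′ p) (proj₁ (insert-invariant {f = f} {i} {p} inv)))
    (𝟙-yes (f i Bool.≟ f zero) (proj₂ (insert-invariant {f = f} {i} {p} inv)))))
  colour-suc : ∀ c → #colour f c ≡ 𝟙 (f zero Bool.≟ c) + #colour f′ c
  colour-suc c = ∑-allFin-suc n (λ i → 𝟙 (f i Bool.≟ c))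
  open +-*-Solver
  grow : ∀ b {T U : ℕ} (k : Bool → ℕ) → k true ≡ 𝟙 (b Bool.≟ true) + T → k false ≡ 𝟙 (b Bool.≟ false) + U →
         T ! * U ! * k b ≡ k true ! * k false !
  grow true {T} {U} k e e′ rewrite e | e′ =
    solve 3 (λ a b c → a :* b :* c := c :* a :* b) refl (T !) (U !) (suc T)
  grow false {T} {U} k e e′ rewrite e | e′ =
    solve 3 (λ a b c → a :* b :* c := a :* (c :* b)) refl (T !) (U !) (suc U)

-- Sets of edges and the union bound

size : ∀ {n} → Vec Bool n → Bool → ℕ
size []      c = 0
size (b ∷ S) c = 𝟙 (b Bool.≟ c) + size S c

size-lookup : ∀ {n} (S : Vec Bool n) e {c} → lookup S e ≡ c → size S c > 0
size-lookup (b ∷ S) zero    {c} refl = ≤-trans (≤-reflexive (sym (𝟙-yes (b Bool.≟ b) refl))) (m≤m+n _ (size S c))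
size-lookup (b ∷ S) (suc e) {c} eq   = ≤-trans (size-lookup S e eq) (m≤n+m _ (𝟙 (b Bool.≟ c)))

size-total : ∀ {n} (S : Vec Bool n) → size S true + size S false ≡ n
size-total []          = refl
size-total (true ∷ S)  = cong suc (size-total S)
size-total (false ∷ S) = trans (+-suc (size S true) (size S false)) (cong suc (size-total S))

colouring : ∀ {n} → Vec Bool n → Fin (n * 2) → Bool
colouring {n} S i = lookup S (proj₁ (dec n i))

#colouring : ∀ {n} (S : Vec Bool n) c → #colour (colouring S) c ≡ size S c * 2
#colouring []              c = refl
#colouring {suc n} (b ∷ S) c = begin
  #colour (colouring (b ∷ S)) c
    ≡⟨ trans (∑-allFin-suc (suc (n * 2)) f) (cong (𝟙 (b Bool.≟ c) +_) (∑-allFin-suc (n * 2) (f ∘ suc))) ⟩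
  𝟙 (b Bool.≟ c) + (𝟙 (b Bool.≟ c) + #colour (colouring S) c)
    ≡⟨ cong (λ x → 𝟙 (b Bool.≟ c) + (𝟙 (b Bool.≟ c) + x)) (#colouring S c) ⟩
  𝟙 (b Bool.≟ c) + (𝟙 (b Bool.≟ c) + size S c * 2)
    ≡⟨ solve 2 (λ a x → a :+ (a :+ x :* con 2) := (a :+ x) :* con 2) refl (𝟙 (b Bool.≟ c)) (size S c) ⟩
  (𝟙 (b Bool.≟ c) + size S c) * 2 ∎
  where
  f : Fin (suc n * 2) → ℕ
  f i = 𝟙 (colouring (b ∷ S) i Bool.≟ c)
  open ≡-Reasoning
  open +-*-Solver

subsets : ∀ n → List (Vec Bool n)
subsets zero    = [ [] ]
subsets (suc n) = cartesianProductWith _∷_ (true ∷ false ∷ []) (subsets n)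

∈-subsets : ∀ {n} (S : Vec Bool n) → S ∈ subsets n
∈-subsets []      = here refl
∈-subsets (b ∷ S) = ∈-cartesianProductWith⁺ _∷_ (b∈ b) (∈-subsets S)
  where
  b∈ : ∀ b → b ∈ true ∷ false ∷ []
  b∈ true  = here refl
  b∈ false = there (here refl)

∑-subsets-suc : ∀ n (f : Vec Bool (suc n) → ℕ) →
  ∑ (subsets (suc n)) f ≡ ∑[ S ∈ subsets n ] (f (true ∷ S) + f (false ∷ S))
∑-subsets-suc n f = trans (∑-cartesianProductWith _∷_ (true ∷ false ∷ []) (subsets n) f)
  (trans (cong (∑ (subsets n) (f ∘ (true ∷_)) +_) (+-identityʳ _)) (sym (∑-+ (subsets n) _ _)))

proper : ℕ → ℕ → ℕ
proper (suc _) (suc _) = 1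
proper _       _       = 0

weight : ℕ → ℕ → ℕ
weight s t = proper s t * ((s * 2) ! * (t * 2) !)

#disconnected : ℕ → ℕ
#disconnected n = ∑[ p ∈ perms (n * 2) ] 𝟙 (¬? (connected? n p))

#split : ℕ → ℕ
#split n = ∑[ S ∈ subsets n ] weight (size S true) (size S false)

module _ {n} (p : Perm (n * 2)) where

  -- S consists of the edges reachable from h. Links can be undone, `opposite` by itself and a turn
  -- by going round the rest of its cycle, so reachability from h is constant along links. The edge
  -- of h is inside and that of h′ outside.
  splits : ∀ h h′ → ¬ Star (Linked (p ⟪_⟫)) h h′ →
           ∃ λ (S : Vec Bool n) → proper (size S true) (size S false) ≡ 1 × Invariant (colouring S) p
  splits h h′ ¬st = S , positive (size-lookup S (proj₁ h) atTrue) (size-lookup S (proj₁ h′) atFalse) , inv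
    where
    component : HalfEdge n → Bool
    component k = does (linked? n p h k)
    S : Vec Bool n
    S = Vec.tabulate (λ e → component (e , false))
    both : ∀ {k k′} → Star (Linked (p ⟪_⟫)) k k′ → Star (Linked (p ⟪_⟫)) k′ k → component k ≡ component k′
    both {k} {k′} st st′ = does-⇔ (mk⇔ (_◅◅ st) (_◅◅ st′)) (linked? n p h k) (linked? n p h k′)
    component-opposite : ∀ k → component (opposite k) ≡ component k
    component-opposite k = both (inj₂ (opposite-involutive k) ◅ Star.ε) (inj₂ refl ◅ Star.ε)
      where
      opposite-involutive : ∀ k → opposite (opposite k) ≡ k
      opposite-involutive (e , b) = cong (e ,_) (Bool.not-involutive b)
    component-next : ∀ k → component (p ⟪ k ⟫) ≡ component k
    component-next k = both
      (Star.map inj₁ (cycle-connectedₕ p (p ⟪ k ⟫) k (trans (cong (cycle p) (enc-dec n _)) (cycle-⟨⟩ p (enc k)))))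
      (inj₁ refl ◅ Star.ε)
    lookup-S : ∀ k → lookup S (proj₁ k) ≡ component k
    lookup-S k@(e , false) = lookup∘tabulate _ e
    lookup-S k@(e , true)  = trans (lookup∘tabulate _ e) (component-opposite k)
    atTrue : lookup S (proj₁ h) ≡ true
    atTrue = trans (lookup-S h) (dec-true (linked? n p h h) Star.ε)
    atFalse : lookup S (proj₁ h′) ≡ false
    atFalse = trans (lookup-S h′) (dec-false (linked? n p h h′) ¬st)
    inv : Invariant (colouring S) p
    inv i = trans (lookup-S (dec n (p ⟨ i ⟩)))
      (trans (cong (λ i → component (dec n (p ⟨ i ⟩))) (sym (enc-dec n i)))
        (trans (component-next (dec n i)) (sym (lookup-S (dec n i)))))
    positive : ∀ {s t} → s > 0 → t > 0 → proper s t ≡ 1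
    positive (s≤s _) (s≤s _) = refl

  disconnected⇒splits : ¬ Connected n p →
    ∃ λ (S : Vec Bool n) → proper (size S true) (size S false) ≡ 1 × Invariant (colouring S) p
  disconnected⇒splits ¬c with anyHalfEdge? (λ h → anyHalfEdge? λ h′ → ¬? (linked? n p h h′))
  ... | yes (h , h′ , ¬st) = splits h h′ ¬st
  ... | no none = contradiction
    (λ h h′ → decidable-stable (linked? n p h h′) (λ ¬st → none (h , h′ , ¬st))) ¬c

-- Union bound: every disconnected permutation preserves some proper S, and `#invariant` bounds the
-- number of permutations that preserve a given S.
#disconnected≤#split : ∀ n → #disconnected n ≤ #split n
#disconnected≤#split n = begin
  ∑[ p ∈ perms (n * 2) ] 𝟙 (¬? (connected? n p))
    ≤⟨ ∑-mono (perms (n * 2)) someSplit ⟩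
  ∑[ p ∈ perms (n * 2) ] ∑[ S ∈ subsets n ] π S * 𝟙 (invariant? (colouring S) p)
    ≡⟨ ∑-swap (perms (n * 2)) (subsets n) _ ⟩
  ∑[ S ∈ subsets n ] ∑[ p ∈ perms (n * 2) ] π S * 𝟙 (invariant? (colouring S) p)
    ≡⟨ ∑-cong (subsets n) (λ S → ∑-*ˡ (perms (n * 2)) (π S) _) ⟩
  ∑[ S ∈ subsets n ] π S * (∑[ p ∈ perms (n * 2) ] 𝟙 (invariant? (colouring S) p))
    ≤⟨ ∑-mono (subsets n) (λ S → *-monoʳ-≤ (π S) (≤-trans (#invariant (colouring S))
        (≤-reflexive (cong₂ (λ a b → a ! * b !) (#colouring S true) (#colouring S false))))) ⟩
  #split n ∎
  where
  open ≤-Reasoning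
  π : Vec Bool n → ℕ
  π S = proper (size S true) (size S false)
  someSplit : ∀ p → 𝟙 (¬? (connected? n p)) ≤ ∑[ S ∈ subsets n ] π S * 𝟙 (invariant? (colouring S) p)
  someSplit p = 𝟙-≤ (¬? (connected? n p)) λ ¬c →
    let S , π≡1 , inv = disconnected⇒splits {n} p ¬c in ≤-trans
      (≤-reflexive (sym (cong₂ _*_ π≡1 (𝟙-yes (invariant? (colouring S) p) inv))))
      (∑-∈ (λ S → π S * 𝟙 (invariant? (colouring S) p)) (∈-subsets S))

-- Recursion for the sum over sets of edges

∑-empty : ∀ n c → ∑[ S ∈ subsets n ] 𝟙 (size S c ≟ 0) ≡ 1
∑-empty zero    c     = refl
∑-empty (suc n) true  = trans (∑-subsets-suc n _) (∑-empty n true)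
∑-empty (suc n) false = trans (∑-subsets-suc n _)
  (trans (∑-cong (subsets n) (λ S → +-identityʳ _)) (∑-empty n false))

-- Let n = s + t, s = a + 1 and t = b + 1. Then 4n^2 + 12 exceeds (2s+2)(2s+1) + (2t+2)(2t+1) + 2n
-- by 8ab. If just one part is empty, the old weight is zero, and the weight 2 (2n)! of the new
-- one-edge part is paid for by the last term.
weight-suc : ∀ s t → weight (suc s) t + weight s (suc t) + 2 * (s + t) * weight s t ≤
  (4 * ((s + t) * (s + t)) + 12) * weight s t +
  2 * ((s + t) * 2) ! * (𝟙 (s ≟ 0) + 𝟙 (t ≟ 0))
weight-suc zero    zero    = z≤n
weight-suc zero    (suc t) = ≤-trans (≤-reflexive (lemma t ((suc t * 2) !))) (m≤n+m _ _)
  where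
  open +-*-Solver
  lemma : ∀ t x → 1 * (2 * x) + 0 + 2 * suc t * 0 ≡ 2 * x * 1
  lemma = solve 2 (λ t x → con 1 :* (con 2 :* x) :+ con 0 :+ con 2 :* (con 1 :+ t) :* con 0 :=
    con 2 :* x :* con 1) refl
weight-suc (suc s) zero    rewrite +-identityʳ s =
  ≤-trans (≤-reflexive (lemma s ((suc s * 2) !))) (m≤n+m _ _)
  where
  open +-*-Solver
  lemma : ∀ s x → 0 + 1 * (x * 2) + 2 * suc s * 0 ≡ 2 * x * 1
  lemma = solve 2 (λ s x → con 0 :+ con 1 :* (x :* con 2) :+ con 2 :* (con 1 :+ s) :* con 0 :=
    con 2 :* x :* con 1) refl
weight-suc (suc a) (suc b) = ≤-trans (m≤m+n _ (8 * (a * b) * (A * B)))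
  (≤-trans (≤-reflexive (lemma a b A B)) (m≤m+n _ _))
  where
  A B : ℕ
  A = (suc a * 2) !
  B = (suc b * 2) !
  open +-*-Solver
  lemma : ∀ a b A B →
    1 * (suc (suc (suc a * 2)) * (suc (suc a * 2) * A) * B) +
    1 * (A * (suc (suc (suc b * 2)) * (suc (suc b * 2) * B))) +
    2 * (suc a + suc b) * (1 * (A * B)) + 8 * (a * b) * (A * B) ≡
    (4 * ((suc a + suc b) * (suc a + suc b)) + 12) * (1 * (A * B))
  lemma = solve 4 (λ a b A B →
    con 1 :* ((con 4 :+ a :* con 2) :* ((con 3 :+ a :* con 2) :* A) :* B) :+
    con 1 :* (A :* ((con 4 :+ b :* con 2) :* ((con 3 :+ b :* con 2) :* B))) :+
    con 2 :* ((con 1 :+ a) :+ (con 1 :+ b)) :* (con 1 :* (A :* B)) :+ con 8 :* (a :* b) :* (A :* B) :=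
    (con 4 :* (((con 1 :+ a) :+ (con 1 :+ b)) :* ((con 1 :+ a) :+ (con 1 :+ b))) :+ con 12) :* (con 1 :* (A :* B))) refl

-- The new edge joins either part of each S. The boundary term of `weight-suc` occurs for the empty
-- and for the full set only, hence 2 + 2 = 4.
#split-suc : ∀ n → #split (suc n) + 2 * n * #split n ≤ (4 * (n * n) + 12) * #split n + 4 * (n * 2) !
#split-suc n = begin
  #split (suc n) + 2 * n * #split n
    ≡⟨ cong₂ _+_ (∑-subsets-suc n _) (sym (∑-*ˡ (subsets n) (2 * n) w)) ⟩
  ∑ (subsets n) w′ + (∑[ S ∈ subsets n ] 2 * n * w S)
    ≡⟨ ∑-+ (subsets n) w′ _ ⟨
  ∑[ S ∈ subsets n ] (w′ S + 2 * n * w S)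
    ≤⟨ ∑-mono (subsets n) pointwise ⟩
  ∑[ S ∈ subsets n ] (K * w S + 2 * (n * 2) ! * z S)
    ≡⟨ ∑-+ (subsets n) _ _ ⟩
  (∑[ S ∈ subsets n ] K * w S) + (∑[ S ∈ subsets n ] 2 * (n * 2) ! * z S)
    ≡⟨ cong₂ _+_ (∑-*ˡ (subsets n) K w) (∑-*ˡ (subsets n) (2 * (n * 2) !) z) ⟩
  K * #split n + 2 * (n * 2) ! * ∑ (subsets n) z
    ≡⟨ cong (λ x → K * #split n + 2 * (n * 2) ! * x)
        (trans (∑-+ (subsets n) _ _) (cong₂ _+_ (∑-empty n true) (∑-empty n false))) ⟩
  K * #split n + 2 * (n * 2) ! * 2
    ≡⟨ cong (K * #split n +_) (solve 1 (λ x → con 2 :* x :* con 2 := con 4 :* x) refl ((n * 2) !)) ⟩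
  K * #split n + 4 * (n * 2) ! ∎
  where
  open ≤-Reasoning
  open +-*-Solver
  K = 4 * (n * n) + 12
  w w′ z : Vec Bool n → ℕ
  w  S = weight (size S true) (size S false)
  w′ S = weight (suc (size S true)) (size S false) + weight (size S true) (suc (size S false))
  z  S = 𝟙 (size S true ≟ 0) + 𝟙 (size S false ≟ 0)
  pointwise : ∀ S → w′ S + 2 * n * w S ≤ K * w S + 2 * (n * 2) ! * z S
  pointwise S = subst (λ n → w′ S + 2 * n * w S ≤ (4 * (n * n) + 12) * w S + 2 * (n * 2) ! * z S)
    (size-total S) (weight-suc (size S true) (size S false))

-- The step from n to n + 1 needs 12 C ≤ 4 n (C - 1), hence C ≥ 2 and n ≥ 6.

recursionStep : ∀ {n m} c {x y F} → n ≡ 6 + m →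
  y + 2 * n * x ≤ (4 * (n * n) + 12) * x + 4 * F → n * x ≤ (2 + c) * F →
  suc n * y ≤ (2 + c) * ((2 + n * 2) * ((1 + n * 2) * F))
recursionStep {n} {m} c {x} {y} {F} n≡ y-bound x-bound = begin
  suc n * y
    ≤⟨ *-monoʳ-≤ (suc n) (*-cancelˡ-≤ n {{n≢0}} ny-bound) ⟩
  suc n * ((2 + c) * (2 * (2 * n + 1)) * F)
    ≡⟨ solve 3 (λ n c f → (con 1 :+ n) :* (c :* (con 2 :* (con 2 :* n :+ con 1)) :* f) :=
        c :* ((con 2 :+ n :* con 2) :* ((con 1 :+ n :* con 2) :* f))) refl n (2 + c) F ⟩
  (2 + c) * ((2 + n * 2) * ((1 + n * 2) * F)) ∎
  where
  open ≤-Reasoning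
  open +-*-Solver
  n≢0 : NonZero n
  n≢0 = subst NonZero (sym n≡) _
  K : ℕ
  -- This is 4n^2 - 2n + 12 at n = 6 + m, written without subtraction.
  K = 4 * (m * m) + 46 * m + 144
  K-eq : ∀ m {n} → n ≡ 6 + m →
    (4 * (n * n) + 12) * x + 4 * F ≡ (4 * (m * m) + 46 * m + 144) * x + 4 * F + 2 * n * x
  K-eq m refl = solve 3 (λ m x f →
      (con 4 :* ((con 6 :+ m) :* (con 6 :+ m)) :+ con 12) :* x :+ con 4 :* f :=
      (con 4 :* (m :* m) :+ con 46 :* m :+ con 144) :* x :+ con 4 :* f :+ con 2 :* (con 6 :+ m) :* x)
      refl m x F
  slack : ∀ m {n} → n ≡ 6 + m →
    (4 * (m * m) + 46 * m + 144) * ((2 + c) * F) + 4 * n * F + (4 * m + (12 + 4 * m) * c) * F ≡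
    n * ((2 + c) * (2 * (2 * n + 1)) * F)
  slack m refl = solve 3 (λ m c f →
      (con 4 :* (m :* m) :+ con 46 :* m :+ con 144) :* ((con 2 :+ c) :* f) :+
        con 4 :* (con 6 :+ m) :* f :+ (con 4 :* m :+ (con 12 :+ con 4 :* m) :* c) :* f :=
      (con 6 :+ m) :* ((con 2 :+ c) :* (con 2 :* (con 2 :* (con 6 :+ m) :+ con 1)) :* f))
      refl m c F
  ny-bound : n * y ≤ n * ((2 + c) * (2 * (2 * n + 1)) * F)
  ny-bound = begin
    n * y
      ≤⟨ *-monoʳ-≤ n (+-cancelʳ-≤ (2 * n * x) y (K * x + 4 * F)
          (≤-trans y-bound (≤-reflexive (K-eq m n≡)))) ⟩
    n * (K * x + 4 * F)
      ≡⟨ solve 4 (λ n k x f → n :* (k :* x :+ con 4 :* f) := k :* (n :* x) :+ con 4 :* n :* f) refl n K x F ⟩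
    K * (n * x) + 4 * n * F            ≤⟨ +-monoˡ-≤ (4 * n * F) (*-monoʳ-≤ K x-bound) ⟩
    K * ((2 + c) * F) + 4 * n * F      ≤⟨ m≤m+n _ ((4 * m + (12 + 4 * m) * c) * F) ⟩
    K * ((2 + c) * F) + 4 * n * F + (4 * m + (12 + 4 * m) * c) * F  ≡⟨ slack m n≡ ⟩
    n * ((2 + c) * (2 * (2 * n + 1)) * F)  ∎

-- n is kept separate from 6 + m, because (6 + m) * 2 ! would unfold.

recursionBound : (X : ℕ → ℕ) →
  (∀ n → X (suc n) + 2 * n * X n ≤ (4 * (n * n) + 12) * X n + 4 * (n * 2) !) →
  ∀ m {n} → n ≡ 6 + m → n * X n ≤ (2 + 6 * X 6) * (n * 2) !
recursionBound X X-suc zero    {n}     n≡ = ≤-trans (≤-reflexive (cong (λ n → n * X n) n≡))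
  (≤-trans (m≤n+m (6 * X 6) 2) (m≤m*n (2 + 6 * X 6) ((n * 2) !) {{n * 2 !≢0}}))
recursionBound X X-suc (suc m) {suc n} n≡ =
  recursionStep (6 * X 6) {X n} {X (suc n)} {(n * 2) !} (suc-injective n≡) (X-suc n)
    (recursionBound X X-suc m (suc-injective n≡))

abstract
  disconnected-rare : ∃ λ C → ∀ n → 6 ≤ n → n * #disconnected n ≤ C * (n * 2) !
  -- The summand `6 * #split 6` settles n = 6, because a factorial is at least 1; the summand 2
  -- makes the constant large enough for the inductive step.
  disconnected-rare = 2 + 6 * #split 6 , λ n 6≤n → ≤-trans (*-monoʳ-≤ n (#disconnected≤#split n))
    (recursionBound #split #split-suc (n ∸ 6) (sym (m+[n∸m]≡n 6≤n)))

-- Rational arithmetic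

abstract
  ι : ℕ → ℚ
  ι m = pos m / 1

  ι-def : ∀ m → ι m ≡ pos m / 1
  ι-def m = refl

  ι-0 : ι 0 ≡ 0ℚ
  ι-0 = refl

  ι-1 : ι 1 ≡ 1ℚ
  ι-1 = refl

  /-*-cancel : ∀ i n .{{_ : NonZero n}} → (i / n) *ℚ ι n ≡ i / 1
  /-*-cancel i n@(suc _) = ℚ.toℚᵘ-injective (begin
    ℚ.toℚᵘ ((i / n) *ℚ ι n)             ≈⟨ ℚ.toℚᵘ-homo-* (i / n) (ι n) ⟩
    ℚ.toℚᵘ (i / n) ℚᵘ.* ℚ.toℚᵘ (ι n)    ≈⟨ ℚᵘ.*-cong (toℚᵘ-/ i n) (toℚᵘ-/ (pos n) 1) ⟩
    (i ℚᵘ./ n) ℚᵘ.* ((pos n) ℚᵘ./ 1)      ≈⟨ ℚᵘ.*≡* (trans (ℤ.*-assoc i (pos n) 1ℤ)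
                                            (cong (i ℤ.*_) (trans (ℤ.*-identityʳ (pos n)) (cong pos (sym (*-identityʳ n)))))) ⟩
    i ℚᵘ./ 1                            ≈⟨ toℚᵘ-/ i 1 ⟨
    ℚ.toℚᵘ (i / 1)                      ∎)
    where open ℚᵘ.≃-Reasoning

  ι-+ : ∀ m n → ι (m + n) ≡ ι m +ℚ ι n
  ι-+ m n = ℚ.toℚᵘ-injective (begin
    ℚ.toℚᵘ (ι (m + n))                  ≈⟨ toℚᵘ-/ (pos (m + n)) 1 ⟩
    (pos (m + n)) ℚᵘ./ 1
      ≈⟨ ℚᵘ.*≡* (cong (ℤ._* 1ℤ) (sym (cong₂ ℤ._+_ (ℤ.*-identityʳ (pos m)) (ℤ.*-identityʳ (pos n))))) ⟩
    ((pos m) ℚᵘ./ 1) ℚᵘ.+ ((pos n) ℚᵘ./ 1)  ≈⟨ ℚᵘ.+-cong (toℚᵘ-/ (pos m) 1) (toℚᵘ-/ (pos n) 1) ⟨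
    ℚ.toℚᵘ (ι m) ℚᵘ.+ ℚ.toℚᵘ (ι n)      ≈⟨ ℚ.toℚᵘ-homo-+ (ι m) (ι n) ⟨
    ℚ.toℚᵘ (ι m +ℚ ι n)                 ∎)
    where open ℚᵘ.≃-Reasoning

  ι-* : ∀ m n → ι (m * n) ≡ ι m *ℚ ι n
  ι-* m n = ℚ.toℚᵘ-injective (begin
    ℚ.toℚᵘ (ι (m * n))                  ≈⟨ toℚᵘ-/ (pos (m * n)) 1 ⟩
    (pos (m * n)) ℚᵘ./ 1                  ≈⟨ ℚᵘ.*≡* (cong (ℤ._* 1ℤ) (ℤ.pos-* m n)) ⟩
    ((pos m) ℚᵘ./ 1) ℚᵘ.* ((pos n) ℚᵘ./ 1)  ≈⟨ ℚᵘ.*-cong (toℚᵘ-/ (pos m) 1) (toℚᵘ-/ (pos n) 1) ⟨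
    ℚ.toℚᵘ (ι m) ℚᵘ.* ℚ.toℚᵘ (ι n)      ≈⟨ ℚ.toℚᵘ-homo-* (ι m) (ι n) ⟨
    ℚ.toℚᵘ (ι m *ℚ ι n)                 ∎)
    where open ℚᵘ.≃-Reasoning

  ι-≤ : ∀ {m n} → m ≤ n → ι m ≤ℚ ι n
  ι-≤ {m} {n} m≤n = ℚ.toℚᵘ-cancel-≤
    (ℚᵘ.≤-respʳ-≃ (ℚᵘ.≃-sym (toℚᵘ-/ (pos n) 1)) (ℚᵘ.≤-respˡ-≃ (ℚᵘ.≃-sym (toℚᵘ-/ (pos m) 1))
      (ℚᵘ.*≤* (ℤ.*-monoʳ-≤-nonNeg 1ℤ (ℤ.+≤+ m≤n)))))

  ι-< : ∀ {m n} → m < n → ι m <ℚ ι n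
  ι-< {m} {n} m<n = ℚ.<-≤-trans
    (subst (_<ℚ ι m +ℚ 1ℚ) (ℚ.+-identityʳ (ι m)) (ℚ.+-monoʳ-< (ι m) (ℚ.positive⁻¹ 1ℚ)))
    (subst (_≤ℚ ι n) (trans (cong ι (+-comm 1 m)) (ι-+ m 1)) (ι-≤ m<n))

  ι-nonNeg : ∀ n → ℚ.NonNegative (ι n)
  ι-nonNeg n = ℚ.normalize-nonNeg n 1

  ι-pos : ∀ n .{{_ : NonZero n}} → ℚ.Positive (ι n)
  ι-pos n = ℚ.normalize-pos n 1

*-cancelʳ-≡-pos : ∀ r .{{_ : ℚ.Positive r}} {p q} → p *ℚ r ≡ q *ℚ r → p ≡ q
*-cancelʳ-≡-pos r e = ℚ.≤-antisym (ℚ.*-cancelʳ-≤-pos r (ℚ.≤-reflexive e))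
  (ℚ.*-cancelʳ-≤-pos r (ℚ.≤-reflexive (sym e)))

∣-∣-≤ : ∀ {x y b} → 0ℚ ≤ℚ x → x ≤ℚ b → 0ℚ ≤ℚ y → y ≤ℚ b → ∣ x -ℚ y ∣ ≤ℚ b
∣-∣-≤ {x} {y} {b} 0≤x x≤b 0≤y y≤b with ℚ.∣p∣≡p∨∣p∣≡-p (x -ℚ y)
... | inj₁ e = subst (_≤ℚ b) (sym e) (below x y x≤b 0≤y)
  where
  below : ∀ x y → x ≤ℚ b → 0ℚ ≤ℚ y → x -ℚ y ≤ℚ b
  below x y x≤b 0≤y = subst (x -ℚ y ≤ℚ_) (ℚ.+-identityʳ b) (ℚ.+-mono-≤ x≤b (ℚ.neg-antimono-≤ 0≤y))
... | inj₂ e = subst (_≤ℚ b) (sym (trans e (swapped x y)))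
  (subst (y -ℚ x ≤ℚ_) (ℚ.+-identityʳ b) (ℚ.+-mono-≤ y≤b (ℚ.neg-antimono-≤ 0≤x)))
  where
  open ℚ.+-*-Solver
  swapped : ∀ x y → -ℚ (x -ℚ y) ≡ y -ℚ x
  swapped = solve 2 (λ x y → :- (x :- y) := y :- x) refl

-- The law of the number of fixed points

e⁻¹-term-suc : ∀ m → ι (suc m) *ℚ e⁻¹-term (suc m) ≡ -ℚ e⁻¹-term m
e⁻¹-term-suc m = *-cancelʳ-≡-pos (ι (suc m !)) {{ι-pos (suc m !) {{suc m !≢0}}}} (begin
  ι (suc m) *ℚ e⁻¹-term (suc m) *ℚ ι (suc m !)
    ≡⟨ ℚ.*-assoc (ι (suc m)) (e⁻¹-term (suc m)) (ι (suc m !)) ⟩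
  ι (suc m) *ℚ (e⁻¹-term (suc m) *ℚ ι (suc m !))
    ≡⟨ cong (ι (suc m) *ℚ_) (/-*-cancel (-1ℤ ℤ.^ suc m) (suc m !) {{suc m !≢0}}) ⟩
  ι (suc m) *ℚ ((-1ℤ ℤ.^ suc m) / 1)
    ≡⟨ cong (ι (suc m) *ℚ_) (sign (-1^ m)) ⟩
  ι (suc m) *ℚ (-ℚ ((-1ℤ ℤ.^ m) / 1))
    ≡⟨ cong (λ x → ι (suc m) *ℚ (-ℚ x)) (/-*-cancel (-1ℤ ℤ.^ m) (m !) {{m !≢0}}) ⟨
  ι (suc m) *ℚ (-ℚ (e⁻¹-term m *ℚ ι (m !)))
    ≡⟨ solve 3 (λ a t f → a :* (:- (t :* f)) := (:- t) :* (a :* f)) refl (ι (suc m)) (e⁻¹-term m) (ι (m !)) ⟩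
  (-ℚ e⁻¹-term m) *ℚ (ι (suc m) *ℚ ι (m !))
    ≡⟨ cong ((-ℚ e⁻¹-term m) *ℚ_) (ι-* (suc m) (m !)) ⟨
  (-ℚ e⁻¹-term m) *ℚ ι (suc m !) ∎)
  where
  open ≡-Reasoning
  open ℚ.+-*-Solver
  sign : ∀ {i} → i ≡ 1ℤ ⊎ i ≡ -1ℤ → (-1ℤ ℤ.* i) / 1 ≡ -ℚ (i / 1)
  sign (inj₁ refl) = refl
  sign (inj₂ refl) = refl

private
  s : ℕ → ℚ
  s = e⁻¹-partial

-- The derangement recurrence d(m+1) = m (d(m) + d(m-1)) divided by m!, where d(j) is j! times
-- `e⁻¹-partial (suc j)`.
e⁻¹-partial-suc : ∀ m → ι (suc m) *ℚ s (suc (suc m)) ≡ s m +ℚ ι m *ℚ s (suc m)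
e⁻¹-partial-suc m = begin
  ι (suc m) *ℚ (s m +ℚ t m +ℚ t (suc m))
    ≡⟨ ℚ.*-distribˡ-+ (ι (suc m)) _ _ ⟩
  ι (suc m) *ℚ (s m +ℚ t m) +ℚ ι (suc m) *ℚ t (suc m)
    ≡⟨ cong₂ (λ a b → a *ℚ (s m +ℚ t m) +ℚ b) (trans (ι-+ 1 m) (cong (_+ℚ ι m) ι-1)) (e⁻¹-term-suc m) ⟩
  (1ℚ +ℚ ι m) *ℚ (s m +ℚ t m) +ℚ (-ℚ t m)
    ≡⟨ solve 3 (λ m s t → (con 1ℚ :+ m) :* (s :+ t) :+ (:- t) := s :+ m :* (s :+ t)) refl (ι m) (s m) (t m) ⟩
  s m +ℚ ι m *ℚ s (suc m) ∎
  where
  open ≡-Reasoning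
  open ℚ.+-*-Solver
  t = e⁻¹-term

-- The identity `#withFixed-suc` with the closed formula substituted, multiplied by k! / n!. For k
-- at most n it reduces to `e⁻¹-partial-suc` at m = n - k.
e⁻¹-partial-recurrence : ∀ n k →
  ι (suc n) *ℚ s (suc (suc n) ∸ k) +ℚ ι k *ℚ s (suc n ∸ k) ≡
  ι k *ℚ s (suc (suc n) ∸ k) +ℚ (s (suc n ∸ suc k) +ℚ ι n *ℚ s (suc n ∸ k))
e⁻¹-partial-recurrence n k with k ≤? n
... | yes k≤n = subst (λ n → ι (suc n) *ℚ s (suc (suc n) ∸ k) +ℚ ι k *ℚ s (suc n ∸ k) ≡
    ι k *ℚ s (suc (suc n) ∸ k) +ℚ (s (suc n ∸ suc k) +ℚ ι n *ℚ s (suc n ∸ k)))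
    (m∸n+n≡m k≤n) (shifted (n ∸ k))
  where
  open ≡-Reasoning
  open ℚ.+-*-Solver
  shifted : ∀ m → ι (suc (m + k)) *ℚ s (suc (suc (m + k)) ∸ k) +ℚ ι k *ℚ s (suc (m + k) ∸ k) ≡
    ι k *ℚ s (suc (suc (m + k)) ∸ k) +ℚ (s (suc (m + k) ∸ suc k) +ℚ ι (m + k) *ℚ s (suc (m + k) ∸ k))
  shifted m rewrite m+n∸n≡m (suc (suc m)) k | m+n∸n≡m (suc m) k | m+n∸n≡m m k | ι-+ (suc m) k | ι-+ m k = begin
    (ι (suc m) +ℚ ι k) *ℚ s₂ +ℚ ι k *ℚ s₁
      ≡⟨ solve 4 (λ a k s₂ s₁ → (a :+ k) :* s₂ :+ k :* s₁ := a :* s₂ :+ (k :* s₂ :+ k :* s₁)) refl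
          (ι (suc m)) (ι k) s₂ s₁ ⟩
    ι (suc m) *ℚ s₂ +ℚ (ι k *ℚ s₂ +ℚ ι k *ℚ s₁)
      ≡⟨ cong (_+ℚ (ι k *ℚ s₂ +ℚ ι k *ℚ s₁)) (e⁻¹-partial-suc m) ⟩
    s m +ℚ ι m *ℚ s₁ +ℚ (ι k *ℚ s₂ +ℚ ι k *ℚ s₁)
      ≡⟨ solve 5 (λ m k s₂ s₁ s → s :+ m :* s₁ :+ (k :* s₂ :+ k :* s₁) := k :* s₂ :+ (s :+ (m :+ k) :* s₁)) refl
          (ι m) (ι k) s₂ s₁ (s m) ⟩
    ι k *ℚ s₂ +ℚ (s m +ℚ (ι m +ℚ ι k) *ℚ s₁) ∎
    where
    s₂ = s (suc (suc m))
    s₁ = s (suc m)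
... | no k≰n with k ≟ suc n
-- At k = n + 1 only the first partial sum on each side survives, both times with the coefficient n
-- + 1; beyond that all partial sums are empty.
...   | yes refl rewrite m≤n⇒m∸n≡0 (n≤1+n n) | n∸n≡0 n = vanish (ι (suc n)) (ι n) (s (suc n ∸ n))
  where
  open ℚ.+-*-Solver
  vanish : ∀ a b x → a *ℚ x +ℚ a *ℚ 0ℚ ≡ a *ℚ x +ℚ (0ℚ +ℚ b *ℚ 0ℚ)
  vanish = solve 3 (λ a b x → a :* x :+ a :* con 0ℚ := a :* x :+ (con 0ℚ :+ b :* con 0ℚ)) refl
...   | no k≢1+n rewrite m≤n⇒m∸n≡0 (≤∧≢⇒< (≰⇒> k≰n) (k≢1+n ∘ sym)) | m≤n⇒m∸n≡0 (≰⇒> k≰n) | m≤n⇒m∸n≡0 (<⇒≤ (≰⇒> k≰n)) =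
  vanish (ι (suc n)) (ι k) (ι n)
  where
  open ℚ.+-*-Solver
  vanish : ∀ a b c → a *ℚ 0ℚ +ℚ b *ℚ 0ℚ ≡ b *ℚ 0ℚ +ℚ (0ℚ +ℚ c *ℚ 0ℚ)
  vanish = solve 3 (λ a b c → a :* con 0ℚ :+ b :* con 0ℚ := b :* con 0ℚ :+ (con 0ℚ :+ c :* con 0ℚ)) refl

-- Induction on n for all k, as `#withFixed-suc` involves k - 1, k and k + 1. The partial sum has
-- the terms with i at most n - k; it is empty for k > n, where no permutation exists.
#withFixed-formula : ∀ n k → ι (#withFixed n k) *ℚ ι (k !) ≡ ι (n !) *ℚ s (suc n ∸ k)
#withFixed-formula zero    zero    = cong (ι 1 *ℚ_) ι-1
#withFixed-formula zero    (suc k) rewrite 0∸n≡0 k = trans (cong (_*ℚ ι (suc k !)) ι-0)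
  (trans (ℚ.*-zeroˡ (ι (suc k !))) (sym (ℚ.*-zeroʳ (ι 1))))
#withFixed-formula (suc n) k = ∙-cancelʳ (K *ℚ ι (#withFixed n k) *ℚ f) _ _ (begin
  ι (#withFixed (suc n) k) *ℚ f +ℚ K *ℚ ι (#withFixed n k) *ℚ f
    ≡⟨ ℚ.*-distribʳ-+ f (ι (#withFixed (suc n) k)) (K *ℚ ι (#withFixed n k)) ⟨
  (ι (#withFixed (suc n) k) +ℚ K *ℚ ι (#withFixed n k)) *ℚ f
    ≡⟨ cong (_*ℚ f) recurrence ⟩
  (ι (#withFixed₋ n k) +ℚ (ι (suc k) *ℚ ι (#withFixed n (suc k)) +ℚ ι n *ℚ ι (#withFixed n k))) *ℚ f
    ≡⟨ solve 6 (λ d k′ d₁ n d₀ f → (d :+ (k′ :* d₁ :+ n :* d₀)) :* f := d :* f :+ (d₁ :* (k′ :* f) :+ n :* (d₀ :* f))) refl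
        (ι (#withFixed₋ n k)) (ι (suc k)) (ι (#withFixed n (suc k))) (ι n) (ι (#withFixed n k)) f ⟩
  ι (#withFixed₋ n k) *ℚ f +ℚ (ι (#withFixed n (suc k)) *ℚ (ι (suc k) *ℚ f) +ℚ ι n *ℚ (ι (#withFixed n k) *ℚ f))
    ≡⟨ cong₂ (λ a b → a +ℚ b) (pred-formula k) (cong₂ (λ a b → a +ℚ ι n *ℚ b)
        (trans (cong (ι (#withFixed n (suc k)) *ℚ_) (sym (ι-* (suc k) (k !)))) (#withFixed-formula n (suc k)))
        (#withFixed-formula n k)) ⟩
  K *ℚ (F *ℚ s₂) +ℚ (F *ℚ s₀ +ℚ ι n *ℚ (F *ℚ s₁))
    ≡⟨ solve 6 (λ k f s₂ s₀ n s₁ → k :* (f :* s₂) :+ (f :* s₀ :+ n :* (f :* s₁)) := f :* (k :* s₂ :+ (s₀ :+ n :* s₁))) refl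
        K F s₂ s₀ (ι n) s₁ ⟩
  F *ℚ (K *ℚ s₂ +ℚ (s₀ +ℚ ι n *ℚ s₁))
    ≡⟨ cong (F *ℚ_) (e⁻¹-partial-recurrence n k) ⟨
  F *ℚ (ι (suc n) *ℚ s₂ +ℚ K *ℚ s₁)
    ≡⟨ solve 5 (λ f n s₂ k s₁ → f :* (n :* s₂ :+ k :* s₁) := (n :* f) :* s₂ :+ k :* (f :* s₁)) refl
        F (ι (suc n)) s₂ K s₁ ⟩
  (ι (suc n) *ℚ F) *ℚ s₂ +ℚ K *ℚ (F *ℚ s₁)
    ≡⟨ cong₂ (λ a b → a *ℚ s₂ +ℚ K *ℚ b) (ι-* (suc n) (n !)) (#withFixed-formula n k) ⟨
  ι (suc n !) *ℚ s₂ +ℚ K *ℚ (ι (#withFixed n k) *ℚ f)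
    ≡⟨ cong (ι (suc n !) *ℚ s₂ +ℚ_) (ℚ.*-assoc K (ι (#withFixed n k)) f) ⟨
  ι (suc n !) *ℚ s₂ +ℚ K *ℚ ι (#withFixed n k) *ℚ f ∎)
  where
  open ≡-Reasoning
  open ℚ.+-*-Solver
  open import Algebra.Properties.Group ℚ.+-0-group using (∙-cancelʳ)
  K f F s₂ s₁ s₀ : ℚ
  K = ι k
  f = ι (k !)
  F = ι (n !)
  s₂ = s (suc (suc n) ∸ k)
  s₁ = s (suc n ∸ k)
  s₀ = s (suc n ∸ suc k)
  recurrence : ι (#withFixed (suc n) k) +ℚ K *ℚ ι (#withFixed n k) ≡
    ι (#withFixed₋ n k) +ℚ (ι (suc k) *ℚ ι (#withFixed n (suc k)) +ℚ ι n *ℚ ι (#withFixed n k))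
  recurrence = begin
    ι (#withFixed (suc n) k) +ℚ K *ℚ ι (#withFixed n k)
      ≡⟨ cong (ι (#withFixed (suc n) k) +ℚ_) (ι-* k (#withFixed n k)) ⟨
    ι (#withFixed (suc n) k) +ℚ ι (k * #withFixed n k)
      ≡⟨ ι-+ (#withFixed (suc n) k) (k * #withFixed n k) ⟨
    ι (#withFixed (suc n) k + k * #withFixed n k)
      ≡⟨ cong ι (#withFixed-suc n k) ⟩
    ι (#withFixed₋ n k + (suc k * #withFixed n (suc k) + n * #withFixed n k))
      ≡⟨ trans (ι-+ (#withFixed₋ n k) _) (cong (ι (#withFixed₋ n k) +ℚ_)
          (trans (ι-+ (suc k * #withFixed n (suc k)) _) (cong₂ _+ℚ_ (ι-* (suc k) _) (ι-* n _)))) ⟩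
    ι (#withFixed₋ n k) +ℚ (ι (suc k) *ℚ ι (#withFixed n (suc k)) +ℚ ι n *ℚ ι (#withFixed n k)) ∎
  pred-formula : ∀ k → ι (#withFixed₋ n k) *ℚ ι (k !) ≡ ι k *ℚ (F *ℚ s (suc (suc n) ∸ k))
  pred-formula zero    = trans (vanish (ι 1)) (sym (vanish (F *ℚ s (suc (suc n)))))
    where
    vanish : ∀ q → ι 0 *ℚ q ≡ 0ℚ
    vanish q = trans (cong (_*ℚ q) ι-0) (ℚ.*-zeroˡ q)
  pred-formula (suc k) = begin
    ι (#withFixed n k) *ℚ ι (suc k * k !)
      ≡⟨ cong (ι (#withFixed n k) *ℚ_) (ι-* (suc k) (k !)) ⟩
    ι (#withFixed n k) *ℚ (ι (suc k) *ℚ ι (k !))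
      ≡⟨ solve 3 (λ d k f → d :* (k :* f) := k :* (d :* f)) refl (ι (#withFixed n k)) (ι (suc k)) (ι (k !)) ⟩
    ι (suc k) *ℚ (ι (#withFixed n k) *ℚ ι (k !))
      ≡⟨ cong (ι (suc k) *ℚ_) (#withFixed-formula n k) ⟩
    ι (suc k) *ℚ (F *ℚ s (suc n ∸ k)) ∎

-- Conditioning on transitivity

𝟙-¬ : {P : Set} (d : Dec P) → 𝟙 d + 𝟙 (¬? d) ≡ 1
𝟙-¬ (yes _) = refl
𝟙-¬ (no _)  = refl

∑-partition : {A : Set} {P : A → Set} (P? : ∀ x → Dec (P x)) (xs : List A) (f : A → ℕ) →
  (∑[ x ∈ xs ] 𝟙 (P? x) * f x) + (∑[ x ∈ xs ] 𝟙 (¬? (P? x)) * f x) ≡ ∑ xs f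
∑-partition P? xs f = trans (sym (∑-+ xs _ _)) (∑-cong xs λ x →
  trans (sym (*-distribʳ-+ (f x) (𝟙 (P? x)) (𝟙 (¬? (P? x)))))
    (trans (cong (_* f x) (𝟙-¬ (P? x))) (*-identityˡ (f x))))

#withLeaves : ℕ → ℕ → ℕ
#withLeaves n k = length (filter (λ M → #leaves (mapOf M) ≟ k) (rootedMaps n))

-- Abstract, since the normal forms of sums and products of fractions are large.

abstract
  leafProbability : ℕ → ℕ → ℚ
  leafProbability n k = (pos (#withLeaves n k) / length (rootedMaps n)) {{rootedMaps-nonEmpty n}}

  leafLaw-seq : ∀ n k i → seq (leafLaw n k) i ≡ leafProbability n k
  leafLaw-seq n k i = refl

  leafProbability-* : ∀ n k → leafProbability n k *ℚ ι (length (rootedMaps n)) ≡ ι (#withLeaves n k)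
  leafProbability-* n k = trans
    (/-*-cancel (pos (#withLeaves n k)) (length (rootedMaps n)) {{rootedMaps-nonEmpty n}})
    (sym (ι-def (#withLeaves n k)))

  0≤leafProbability : ∀ n k → 0ℚ ≤ℚ leafProbability n k
  0≤leafProbability n k = ℚ.nonNegative⁻¹ (leafProbability n k)
    {{ℚ.normalize-nonNeg (#withLeaves n k) (length (rootedMaps n)) {{rootedMaps-nonEmpty n}}}}

module _ (n k : ℕ) where

  private
    P : List (Perm (suc n * 2))
    P = perms (suc n * 2)
    c? : ∀ p → Dec (Connected (suc n) p)
    c? = connected? (suc n)
    f : Perm (suc n * 2) → ℕ
    f p = 𝟙 (#fixed p ≟ k)
    q : ℚ
    q = leafProbability (suc n) k
    L Lₖ T D A A′ B B′ : ℕ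
    L  = length (rootedMaps (suc n))
    Lₖ = #withLeaves (suc n) k
    T  = (suc n * 2) !
    D  = #withFixed (suc n * 2) k
    A  = ∑[ p ∈ P ] 𝟙 (c? p) * f p
    A′ = ∑[ p ∈ P ] 𝟙 (¬? (c? p)) * f p
    B  = ∑[ p ∈ P ] 𝟙 (c? p) * 1
    B′ = #disconnected (suc n)

    instance
      L≢0 : NonZero L
      L≢0 = rootedMaps-nonEmpty (suc n)

    q*L : q *ℚ ι L ≡ ι Lₖ
    q*L = leafProbability-* (suc n) k

    -- The leaf law is the law of the fixed points among the B transitive permutations. Two
    -- instances of `∑-rootedMaps`, with the weight 1 and with the indicator of k, are joined by q L
    -- = Lₖ, and the common factor 2 (n + 1) is cancelled.
    q*B : q *ℚ ι B ≡ ι A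
    q*B = *-cancelʳ-≡-pos (ι (suc n * 2)) {{ι-pos (suc n * 2)}} (begin
      q *ℚ ι B *ℚ ι (suc n * 2)
        ≡⟨ solve 3 (λ q b n → q :* b :* n := q :* (n :* b)) refl q (ι B) (ι (suc n * 2)) ⟩
      q *ℚ (ι (suc n * 2) *ℚ ι B)
        ≡⟨ cong (q *ℚ_) (trans (sym (ι-* (suc n * 2) B)) (trans (cong ι (sym all)) (ι-* G L))) ⟩
      q *ℚ (ι G *ℚ ι L)
        ≡⟨ solve 3 (λ q g l → q :* (g :* l) := g :* (q :* l)) refl q (ι G) (ι L) ⟩
      ι G *ℚ (q *ℚ ι L)
        ≡⟨ cong (ι G *ℚ_) q*L ⟩
      ι G *ℚ ι Lₖ
        ≡⟨ trans (sym (ι-* G Lₖ)) (trans (cong ι withLeaves) (ι-* (suc n * 2) A)) ⟩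
      ι (suc n * 2) *ℚ ι A
        ≡⟨ ℚ.*-comm (ι (suc n * 2)) (ι A) ⟩
      ι A *ℚ ι (suc n * 2) ∎)
      where
      open ≡-Reasoning
      open ℚ.+-*-Solver
      G = #symmetries {n}
      all : G * L ≡ suc n * 2 * B
      all = trans (cong (G *_) (sym (trans (∑-const (rootedMaps (suc n)) 1) (*-identityʳ L))))
        (∑-rootedMaps {n} (λ _ → 1))
      withLeaves : G * Lₖ ≡ suc n * 2 * A
      withLeaves = trans (cong (G *_) (length-filter-∑ (λ M → #leaves (mapOf M) ≟ k) (rootedMaps (suc n))))
        (∑-rootedMaps {n} (λ j → 𝟙 (j ≟ k)))

    0≤ι : ∀ m → 0ℚ ≤ℚ ι m
    0≤ι m = ℚ.nonNegative⁻¹ (ι m) {{ι-nonNeg m}}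

    0≤q : 0ℚ ≤ℚ q
    0≤q = 0≤leafProbability (suc n) k

    q≤1 : q ≤ℚ 1ℚ
    q≤1 = ℚ.*-cancelʳ-≤-pos (ι L) {{ι-pos L}} (subst₂ _≤ℚ_ (sym q*L) (sym (ℚ.*-identityˡ (ι L)))
      (ι-≤ (length-filter (λ M → #leaves (mapOf M) ≟ k) (rootedMaps (suc n)))))

    T≡B+B′ : T ≡ B + B′
    T≡B+B′ = trans (sym (∑-perms-1 (suc n * 2))) (trans (sym (∑-partition c? P (λ _ → 1)))
      (cong (B +_) (∑-cong P (λ p → *-identityʳ (𝟙 (¬? (c? p)))))))

    A′≤B′ : A′ ≤ B′
    A′≤B′ = ∑-mono P (λ p → ≤-trans (*-monoʳ-≤ (𝟙 (¬? (c? p))) (𝟙-≤ (#fixed p ≟ k) {1} (λ _ → ≤-refl)))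
      (≤-reflexive (*-identityʳ _)))

  -- Since q T - D = q B′ - A′, and both terms lie between 0 and B′.

  leafProbability-bound : ∣ q *ℚ ι T -ℚ ι D ∣ ≤ℚ ι B′
  leafProbability-bound = subst (λ x → ∣ x ∣ ≤ℚ ι B′) (sym difference)
    (∣-∣-≤ (subst (_≤ℚ q *ℚ ι B′) (ℚ.*-zeroˡ (ι B′)) (ℚ.*-monoʳ-≤-nonNeg (ι B′) {{ι-nonNeg B′}} 0≤q))
           (subst (q *ℚ ι B′ ≤ℚ_) (ℚ.*-identityˡ (ι B′)) (ℚ.*-monoʳ-≤-nonNeg (ι B′) {{ι-nonNeg B′}} q≤1))
           (0≤ι A′) (ι-≤ A′≤B′))
    where
    open ≡-Reasoning
    open ℚ.+-*-Solver
    difference : q *ℚ ι T -ℚ ι D ≡ q *ℚ ι B′ -ℚ ι A′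
    difference = begin
      q *ℚ ι T -ℚ ι D
        ≡⟨ cong₂ (λ t d → q *ℚ t -ℚ d) (trans (cong ι T≡B+B′) (ι-+ B B′))
            (trans (cong ι (sym (∑-partition c? P f))) (ι-+ A A′)) ⟩
      q *ℚ (ι B +ℚ ι B′) -ℚ (ι A +ℚ ι A′)
        ≡⟨ cong (_-ℚ (ι A +ℚ ι A′)) (ℚ.*-distribˡ-+ q (ι B) (ι B′)) ⟩
      (q *ℚ ι B +ℚ q *ℚ ι B′) -ℚ (ι A +ℚ ι A′)
        ≡⟨ cong (λ x → (x +ℚ q *ℚ ι B′) -ℚ (ι A +ℚ ι A′)) q*B ⟩
      (ι A +ℚ q *ℚ ι B′) -ℚ (ι A +ℚ ι A′)
        ≡⟨ solve 3 (λ a b c → (a :+ b) :- (a :+ c) := b :- c) refl (ι A) (q *ℚ ι B′) (ι A′) ⟩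
      q *ℚ ι B′ -ℚ ι A′ ∎

  fixedProbability : ι D ≡ (1/! k *ℚ e⁻¹-partial (suc (suc n * 2) ∸ k)) *ℚ ι T
  fixedProbability = *-cancelʳ-≡-pos (ι (k !)) {{ι-pos (k !) {{k !≢0}}}} (begin
    ι D *ℚ ι (k !)             ≡⟨ #withFixed-formula (suc n * 2) k ⟩
    ι T *ℚ x                   ≡⟨ ℚ.*-identityˡ (ι T *ℚ x) ⟨
    1ℚ *ℚ (ι T *ℚ x)           ≡⟨ cong (_*ℚ (ι T *ℚ x)) (/-*-cancel 1ℤ (k !) {{k !≢0}}) ⟨
    (1/! k *ℚ ι (k !)) *ℚ (ι T *ℚ x)
      ≡⟨ solve 4 (λ i f t x → (i :* f) :* (t :* x) := ((i :* x) :* t) :* f) refl (1/! k) (ι (k !)) (ι T) x ⟩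
    ((1/! k *ℚ x) *ℚ ι T) *ℚ ι (k !) ∎)
    where
    open ≡-Reasoning
    open ℚ.+-*-Solver
    x = e⁻¹-partial (suc (suc n * 2) ∸ k)

  -- The previous bound divided by T: the error is at most the probability of intransitivity, which
  -- is at most C / (n + 1).
  leafProbability-error : ∀ {C} → suc n * #disconnected (suc n) ≤ C * (suc n * 2) ! →
    ∣ leafProbability (suc n) k -ℚ 1/! k *ℚ e⁻¹-partial (suc (suc n * 2) ∸ k) ∣ *ℚ ι (suc n) ≤ℚ ι C
  leafProbability-error {C} rare = ℚ.*-cancelʳ-≤-pos (ι T) {{ι-pos T {{(suc n * 2) !≢0}}}} (begin
    ∣ q -ℚ x ∣ *ℚ ι (suc n) *ℚ ι T
      ≡⟨ solve 3 (λ d n t → d :* n :* t := n :* (d :* t)) refl ∣ q -ℚ x ∣ (ι (suc n)) (ι T) ⟩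
    ι (suc n) *ℚ (∣ q -ℚ x ∣ *ℚ ι T)
      ≡⟨ cong (λ t → ι (suc n) *ℚ (∣ q -ℚ x ∣ *ℚ t)) (ℚ.0≤p⇒∣p∣≡p (0≤ι T)) ⟨
    ι (suc n) *ℚ (∣ q -ℚ x ∣ *ℚ ∣ ι T ∣)
      ≡⟨ cong (ι (suc n) *ℚ_) (ℚ.∣p*q∣≡∣p∣*∣q∣ (q -ℚ x) (ι T)) ⟨
    ι (suc n) *ℚ ∣ (q -ℚ x) *ℚ ι T ∣
      ≡⟨ cong (λ y → ι (suc n) *ℚ ∣ y ∣) (trans
          (solve 3 (λ q x t → (q :- x) :* t := q :* t :- x :* t) refl q x (ι T))
          (cong (λ y → q *ℚ ι T -ℚ y) (sym fixedProbability))) ⟩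
    ι (suc n) *ℚ ∣ q *ℚ ι T -ℚ ι D ∣
      ≤⟨ ℚ.*-monoˡ-≤-nonNeg (ι (suc n)) {{ι-nonNeg (suc n)}} leafProbability-bound ⟩
    ι (suc n) *ℚ ι B′
      ≡⟨ ι-* (suc n) B′ ⟨
    ι (suc n * B′)
      ≤⟨ ι-≤ rare ⟩
    ι (C * T)
      ≡⟨ ι-* C T ⟩
    ι C *ℚ ι T ∎)
    where
    open ℚ.≤-Reasoning
    open ℚ.+-*-Solver
    x = 1/! k *ℚ e⁻¹-partial (suc (suc n * 2) ∸ k)

-- Convergence

1/!≤1 : ∀ k → 1/! k ≤ℚ 1ℚ
1/!≤1 k = 1/-antimono 1 (k !) {{_}} {{k !≢0}} (>-nonZero⁻¹ (k !) {{k !≢0}})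

0≤1/! : ∀ k → 0ℚ ≤ℚ 1/! k
0≤1/! k = 0≤1/ (k !) {{k !≢0}}

*-contracts : ∀ {a x ε} → 0ℚ ≤ℚ a → a ≤ℚ 1ℚ → ∣ x ∣ <ℚ ε → ∣ a *ℚ x ∣ <ℚ ε
*-contracts {a} {x} {ε} 0≤a a≤1 x<ε = ℚ.≤-<-trans (begin
  ∣ a *ℚ x ∣      ≡⟨ ℚ.∣p*q∣≡∣p∣*∣q∣ a x ⟩
  ∣ a ∣ *ℚ ∣ x ∣  ≡⟨ cong (_*ℚ ∣ x ∣) (ℚ.0≤p⇒∣p∣≡p 0≤a) ⟩
  a *ℚ ∣ x ∣      ≤⟨ ℚ.*-monoʳ-≤-nonNeg ∣ x ∣ {{ℚ.∣-∣-nonNeg x}} a≤1 ⟩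
  1ℚ *ℚ ∣ x ∣     ≡⟨ ℚ.*-identityˡ ∣ x ∣ ⟩
  ∣ x ∣           ∎) x<ε
  where open ℚ.≤-Reasoning

∣-∣-triangle-½ : ∀ {ε} x y z → ∣ x -ℚ y ∣ <ℚ ½ *ℚ ε → ∣ y -ℚ z ∣ <ℚ ½ *ℚ ε → ∣ x -ℚ z ∣ <ℚ ε
∣-∣-triangle-½ {ε} x y z p q = subst₂ _<ℚ_ (cong ∣_∣ (telescope x y z)) (½+½ ε)
  (ℚ.≤-<-trans (ℚ.∣p+q∣≤∣p∣+∣q∣ (x -ℚ y) (y -ℚ z)) (ℚ.+-mono-< p q))
  where
  open ℚ.+-*-Solver
  telescope : ∀ x y z → (x -ℚ y) +ℚ (y -ℚ z) ≡ x -ℚ z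
  telescope = solve 3 (λ x y z → (x :- y) :+ (y :- z) := x :- z) refl

-- x is at most C / n, and C / n is less than 1 / (d + 1); the divisions are replaced by
-- multiplications with positive numbers.
scaled-bound⇒< : ∀ C d n {x} → C * suc d < n → x *ℚ ι n ≤ℚ ι C → x <ℚ 1ℤ / suc d
scaled-bound⇒< C d n {x} C<n x*n≤C = ℚ.*-cancelʳ-<-nonNeg (ι n) {{ι-nonNeg n}}
  (ℚ.≤-<-trans x*n≤C (ℚ.*-cancelʳ-<-nonNeg (ι (suc d)) {{ι-nonNeg (suc d)}}
    (subst₂ _<ℚ_ (ι-* C (suc d)) scaled (ι-< C<n))))
  where
  open ≡-Reasoning
  open ℚ.+-*-Solver
  scaled : ι n ≡ (1ℤ / suc d) *ℚ ι n *ℚ ι (suc d)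
  scaled = begin
    ι n                                       ≡⟨ ℚ.*-identityˡ (ι n) ⟨
    1ℚ *ℚ ι n                                 ≡⟨ cong (_*ℚ ι n) (/-*-cancel 1ℤ (suc d)) ⟨
    (1ℤ / suc d) *ℚ ι (suc d) *ℚ ι n
      ≡⟨ solve 3 (λ a b c → a :* b :* c := a :* c :* b) refl (1ℤ / suc d) (ι (suc d)) (ι n) ⟩
    (1ℤ / suc d) *ℚ ι n *ℚ ι (suc d)          ∎

*-distribˡ-- : ∀ a b c → a *ℚ (b -ℚ c) ≡ a *ℚ b -ℚ a *ℚ c
*-distribˡ-- = solve 3 (λ a b c → a :* (b :- c) := a :* b :- a :* c) refl
  where open ℚ.+-*-Solver

module _ (k : ℕ) {ε : ℚ} (C d M : ℕ)
         (rare  : ∀ n → 6 ≤ n → n * #disconnected n ≤ C * (n * 2) !)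
         (1/d≤½ε : 1ℤ / suc d ≤ℚ ½ *ℚ ε)
         (close : ∀ i j → M ≤ i → M ≤ j → ∣ e⁻¹-partial i -ℚ e⁻¹-partial j ∣ <ℚ ½ *ℚ ε) where

  -- In the threshold, 6 makes `rare` applicable, `suc (C * suc d)` pushes C / n below 1 / (d + 1),
  -- and `M + k` keeps the index of the partial sum at least M after k is subtracted. The partial
  -- sum is the intermediate point, with half of ε on either side.
  leafLaw-close : ∀ n → 6 + (suc (C * suc d) + (M + k)) ≤ n → leafLaw n k ≈[ ε ] poisson₁ k
  leafLaw-close (suc n) n-large = M , λ i M≤i →
    subst₂ (λ x y → ∣ x -ℚ y ∣ <ℚ ε) (sym (leafLaw-seq (suc n) k i)) (sym (poisson₁-seq i))
      (∣-∣-triangle-½ (leafProbability (suc n) k)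
        (1/! k *ℚ e⁻¹-partial (suc (suc n * 2) ∸ k)) (1/! k *ℚ e⁻¹-partial i) first (second i M≤i))
    where
    poisson₁-seq : ∀ i → seq (poisson₁ k) i ≡ 1/! k *ℚ e⁻¹-partial i
    poisson₁-seq i = refl
    rest≤n : suc (C * suc d) + (M + k) ≤ suc n
    rest≤n = ≤-trans (m≤n+m _ 6) n-large
    first : ∣ leafProbability (suc n) k -ℚ 1/! k *ℚ e⁻¹-partial (suc (suc n * 2) ∸ k) ∣ <ℚ ½ *ℚ ε
    first = ℚ.<-≤-trans (scaled-bound⇒< C d (suc n) (≤-trans (m≤m+n _ (M + k)) rest≤n)
      (leafProbability-error n k {C} (rare (suc n) (≤-trans (m≤m+n 6 _) n-large)))) 1/d≤½ε
    M≤j : M ≤ suc (suc n * 2) ∸ k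
    M≤j = m+n≤o⇒m≤o∸n M (≤-trans (≤-trans (m≤n+m (M + k) (suc (C * suc d))) rest≤n)
      (≤-trans (m≤m*n (suc n) 2) (n≤1+n (suc n * 2))))
    second : ∀ i → M ≤ i →
      ∣ 1/! k *ℚ e⁻¹-partial (suc (suc n * 2) ∸ k) -ℚ 1/! k *ℚ e⁻¹-partial i ∣ <ℚ ½ *ℚ ε
    second i M≤i = subst (λ x → ∣ x ∣ <ℚ ½ *ℚ ε)
      (*-distribˡ-- (1/! k) (e⁻¹-partial (suc (suc n * 2) ∸ k)) (e⁻¹-partial i))
      (*-contracts (0≤1/! k) (1/!≤1 k) (close (suc (suc n * 2) ∸ k) i M≤j M≤i))

leafLaw-converges : ∀ k → (λ n → leafLaw n k) ⟶ poisson₁ k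
leafLaw-converges k ε 0<ε = _ , leafLaw-close k (proj₁ rare) (proj₁ tiny) (proj₁ close)
  (proj₂ rare) (proj₂ tiny) (proj₂ close)
  where
  rare  = disconnected-rare
  tiny  = archimedean (½ *ℚ ε) (0<½* 0<ε)
  close = cauchy e⁻¹ (½ *ℚ ε) (0<½* 0<ε)

∣-∣-sum-½ : ∀ {ε} a b c d → ∣ a -ℚ b ∣ <ℚ ½ *ℚ ε → ∣ c -ℚ d ∣ <ℚ ½ *ℚ ε →
            ∣ (a +ℚ c) -ℚ (b +ℚ d) ∣ <ℚ ε
∣-∣-sum-½ {ε} a b c d p q = subst₂ _<ℚ_ (cong ∣_∣ (regroup a b c d)) (½+½ ε)
  (ℚ.≤-<-trans (ℚ.∣p+q∣≤∣p∣+∣q∣ (a -ℚ b) (c -ℚ d)) (ℚ.+-mono-< p q))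
  where
  open ℚ.+-*-Solver
  regroup : ∀ a b c d → (a -ℚ b) +ℚ (c -ℚ d) ≡ (a +ℚ c) -ℚ (b +ℚ d)
  regroup = solve 4 (λ a b c d → (a :- b) :+ (c :- d) := (a :+ c) :- (b :+ d)) refl

⟶-+ᵣ : ∀ (u v : ℕ → ℝ) (x y : ℝ) → u ⟶ x → v ⟶ y → (λ n → u n +ᵣ v n) ⟶ (x +ᵣ y)
⟶-+ᵣ u v x y u⟶x v⟶y ε 0<ε = N₁ + N₂ , λ n N≤n →
  let I₁ , p = proj₂ uₙ n (≤-trans (m≤m+n N₁ N₂) N≤n)
      I₂ , q = proj₂ vₙ n (≤-trans (m≤n+m N₂ N₁) N≤n)
  in I₁ + I₂ , λ i I≤i → subst₂ (λ a b → ∣ a -ℚ b ∣ <ℚ ε)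
    (sym (+ᵣ-seq (u n) (v n) i)) (sym (+ᵣ-seq x y i))
    (∣-∣-sum-½ (seq (u n) i) (seq x i) (seq (v n) i) (seq y i)
      (p i (≤-trans (m≤m+n I₁ I₂) I≤i)) (q i (≤-trans (m≤n+m I₂ I₁) I≤i)))
  where
  +ᵣ-seq : ∀ x y i → seq (x +ᵣ y) i ≡ seq x i +ℚ seq y i
  +ᵣ-seq x y i = refl
  uₙ = u⟶x (½ *ℚ ε) (0<½* 0<ε)
  vₙ = v⟶y (½ *ℚ ε) (0<½* 0<ε)
  N₁ N₂ : ℕ
  N₁ = proj₁ uₙ
  N₂ = proj₁ vₙ

sumTo-⟶ : ∀ (p : ℕ → Law) (q : Law) → (∀ k → (λ n → p n k) ⟶ q k) →
          ∀ k → (λ n → sumTo (p n) k) ⟶ sumTo q k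
sumTo-⟶ p q p⟶q zero    = p⟶q 0
sumTo-⟶ p q p⟶q (suc k) = ⟶-+ᵣ (λ n → sumTo (p n) k) (λ n → p n (suc k)) (sumTo q k) (q (suc k))
  (sumTo-⟶ p q p⟶q k) (p⟶q (suc k))

-- At a given x both distribution functions are sums over the same finite range, so convergence of
-- the masses is enough.
cdf-⟶ : ∀ (p : ℕ → Law) (q : Law) → (∀ k → (λ n → p n k) ⟶ q k) →
        ∀ x → (λ n → cdf (p n) x) ⟶ cdf q x
cdf-⟶ p q p⟶q x with floor x
... | pos k    = sumTo-⟶ p q p⟶q k
-- Left of zero both sides are the constant 0, and their distance computes to 0.
... | -[1+ _ ] = λ ε 0<ε → 0 , λ _ _ → 0 , λ _ _ → 0<ε

theorem10 : ConvergesInDistribution leafLaw poisson₁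
theorem10 x _ = cdf-⟶ leafLaw poisson₁ leafLaw-converges x
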